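{- The problem \textsc{Token Sliding} on oriented cographs can be solved in linear time, i.e. there is a linear-time algorithm which, given an instance $(G,S,T)$ in which $G$ is an oriented cograph, decides whether it is a yes-instance.
   Context: An oriented graph is a finite directed graph without loops in which no pair of vertices has directed edges (arcs) in both directions. The underlying undirected graph of an oriented graph $G$, denoted $G^{\mathrm{und}}$, is obtained by removing all edge directions. A set of vertices of $G$ is independent if it is independent in $G^{\mathrm{und}}$. A cograph is an undirected graph that does not contain a $P_4$ (a path on four vertices) as an induced subgraph. An oriented cograph is an oriented graph whose underlying undirected graph is a cograph. Linear time means linear in the size of the input graph (number of vertices plus number of arcs). \textsc{Token Sliding} (on oriented graphs): an instance $(G,S,T)$ consists of an oriented graph $G$ and two independent sets $S,T$ of $G$. The question is whether there is a sequence $\langle S=I_0,I_1,\dots,I_\ell=T\rangle$ such that each $I_i$ ($0\le i\le \ell$) is an independent set of $G$ and, for each $0\le i\le \ell-1$, there is an arc $(u,v)$ of $G$ with $I_i\setminus I_{i+1}=\{u\}$ and $I_{i+1}\setminus I_i=\{v\}$ (a token slides from $u$ to the unoccupied out-neighbour $v$). The instance is a yes-instance if such a sequence exists. -}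

module Defs where

open import Data.Bool using (Bool; if_then_else_)
open import Data.Fin using (Fin; toℕ; fromℕ; inject₁) renaming (zero to fzero; suc to fsuc)
open import Data.Fin.Subset using (Subset; ⁅_⁆; _─_) renaming (_∈_ to _∈ₛ_)
open import Data.List using (List; []; _∷_; length; map)
open import Data.List.Membership.Propositional using (_∈_; _∉_)
open import Data.List.Relation.Unary.Unique.Propositional using (Unique)
open import Data.Nat using (ℕ; zero; suc; _+_; _*_; _∸_; _^_; _≤_; _<_; _<ᵇ_; _≡ᵇ_)
open import Data.Nat.Properties using (1+n≢n)
open import Data.Product using (Σ; ∃-syntax; _×_; _,_; proj₁; proj₂)
open import Data.Sum using (_⊎_; swap; [_,_]′)
open import Data.Vec using (toList)
open import Function using (_∘_)
open import Function.Bundles using (_⇔_)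
open import Function.Definitions using (Injective)
open import Level using (0ℓ)
open import Relation.Binary using (Rel; Symmetric; Irreflexive)
open import Relation.Binary.PropositionalEquality using (_≡_; refl)
open import Relation.Nullary using (¬_; Reflects)

------------------------------------------------------------------------
-- Undirected graphs and cographs

record Graph (n : ℕ) : Set₁ where
  field
    Adj    : Rel (Fin n) 0ℓ
    symm   : Symmetric Adj
    irrefl : Irreflexive _≡_ Adj

open Graph public using (Adj)

path : ∀ k → Graph k
path k = record
  { Adj    = λ i j → suc (toℕ i) ≡ toℕ j ⊎ suc (toℕ j) ≡ toℕ i
  ; symm   = swap
  ; irrefl = λ { refl → [ 1+n≢n , 1+n≢n ]′ }
  }

InducedSubgraph : ∀ {k n} → Graph k → Graph n → Set
InducedSubgraph {k} {n} H G =
  Σ (Fin k → Fin n) λ f →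
    Injective _≡_ _≡_ f × (∀ i j → Adj H i j ⇔ Adj G (f i) (f j))

IsCograph : ∀ {n} → Graph n → Set
IsCograph G = ¬ InducedSubgraph (path 4) G

Independent : ∀ {n} → Graph n → Subset n → Set
Independent G I = ∀ {u v} → u ∈ₛ I → v ∈ₛ I → ¬ Adj G u v

------------------------------------------------------------------------
-- Oriented graphs

-- The arcs are listed in an arbitrary order, without repetition, so that
-- `length arcs` is the number of arcs.
record OrientedGraph : Set where
  field
    order    : ℕ
    arcs     : List (Fin order × Fin order)
    unique   : Unique arcs
    loopless : ∀ {v} → (v , v) ∉ arcs
    oriented : ∀ {u v} → (u , v) ∈ arcs → (v , u) ∉ arcs

  Arc : Rel (Fin order) 0ℓ
  Arc u v = (u , v) ∈ arcs

  underlying : Graph order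
  underlying = record
    { Adj    = λ u v → Arc u v ⊎ Arc v u
    ; symm   = swap
    ; irrefl = λ { refl → [ loopless , loopless ]′ }
    }

  VertexSet : Set
  VertexSet = Subset order

open OrientedGraph public

IsOrientedCograph : OrientedGraph → Set
IsOrientedCograph G = IsCograph (underlying G)

------------------------------------------------------------------------
-- Token Sliding

Slide : (G : OrientedGraph) → Rel (VertexSet G) 0ℓ
Slide G I J = ∃[ u ] ∃[ v ] (Arc G u v × I ─ J ≡ ⁅ u ⁆ × J ─ I ≡ ⁅ v ⁆)

record SlidingSequence (G : OrientedGraph) (S T : VertexSet G) : Set where
  field
    ℓ           : ℕ
    I           : Fin (suc ℓ) → VertexSet G
    start       : I fzero ≡ S
    end         : I (fromℕ ℓ) ≡ T
    independent : ∀ i → Independent (underlying G) (I i)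
    slides      : ∀ (i : Fin ℓ) → Slide G (I (inject₁ i)) (I (fsuc i))

record Instance : Set where
  field
    graph        : OrientedGraph
    source       : VertexSet graph
    target       : VertexSet graph
    source-indep : Independent (underlying graph) source
    target-indep : Independent (underlying graph) target

open Instance public

YesInstance : Instance → Set
YesInstance x = SlidingSequence (graph x) (source x) (target x)

------------------------------------------------------------------------
-- Word RAM programs

-- The memory consists of arrays named by numerals; a program, being a
-- finite text, accesses only finitely many of them.  A scalar variable is
-- cell 0 of an array.

Memory : Set
Memory = ℕ → ℕ → ℕ

_[_∙_≔_] : Memory → ℕ → ℕ → ℕ → Memory
(σ [ a ∙ i ≔ v ]) b j =
  if a ≡ᵇ b then (if i ≡ᵇ j then v else σ b j) else σ b j

infixl 6 _⊕_ _⊖_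
infix  8 _at_

data Expr : Set where
  lit     : ℕ → Expr
  _at_    : ℕ → Expr → Expr
  _⊕_ _⊖_ : Expr → Expr → Expr

⟦_⟧ : Expr → Memory → ℕ
⟦ lit k ⟧  σ = k
⟦ a at e ⟧ σ = σ a (⟦ e ⟧ σ)
⟦ e ⊕ f ⟧  σ = ⟦ e ⟧ σ + ⟦ f ⟧ σ
⟦ e ⊖ f ⟧  σ = ⟦ e ⟧ σ ∸ ⟦ f ⟧ σ

cost : Expr → ℕ
cost (lit k)  = 1
cost (a at e) = suc (cost e)
cost (e ⊕ f)  = suc (cost e + cost f)
cost (e ⊖ f)  = suc (cost e + cost f)

infix  5 _[_]:=_
infixr 4 _⨾_
infix  5 If_Then_Else_ While_Do_

data Program : Set where
  skip           : Program
  _[_]:=_        : ℕ → Expr → Expr → Program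
  _⨾_            : Program → Program → Program
  If_Then_Else_  : Expr → Program → Program → Program
  While_Do_      : Expr → Program → Program

-- W ⊢ p , σ ⇓ τ # t : with words ranging over the numbers below W, the
-- program p started in memory σ halts in memory τ after t unit-cost steps.
-- A condition holds when its value is nonzero.  An assignment of a value
-- that does not fit in a word gets stuck.  Intermediate values and
-- addresses need no separate bound: they exceed the stored values by at
-- most a constant factor and summand depending only on the program.

infix 3 _⊢_,_⇓_#_

data _⊢_,_⇓_#_ (W : ℕ) : Program → Memory → Memory → ℕ → Set where

  ⇓-skip : ∀ {σ} → W ⊢ skip , σ ⇓ σ # 1

  ⇓-assign : ∀ {σ a e f} → ⟦ f ⟧ σ < W →
    W ⊢ a [ e ]:= f , σ ⇓ σ [ a ∙ ⟦ e ⟧ σ ≔ ⟦ f ⟧ σ ] # suc (cost e + cost f)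

  ⇓-seq : ∀ {σ τ υ p q s t} →
    W ⊢ p , σ ⇓ τ # s → W ⊢ q , τ ⇓ υ # t →
    W ⊢ p ⨾ q , σ ⇓ υ # s + t

  ⇓-then : ∀ {σ τ e p q t} → 0 < ⟦ e ⟧ σ →
    W ⊢ p , σ ⇓ τ # t →
    W ⊢ If e Then p Else q , σ ⇓ τ # suc (cost e + t)

  ⇓-else : ∀ {σ τ e p q t} → ⟦ e ⟧ σ ≡ 0 →
    W ⊢ q , σ ⇓ τ # t →
    W ⊢ If e Then p Else q , σ ⇓ τ # suc (cost e + t)

  ⇓-stop : ∀ {σ e p} → ⟦ e ⟧ σ ≡ 0 →
    W ⊢ While e Do p , σ ⇓ σ # suc (cost e)

  ⇓-loop : ∀ {σ τ υ e p s t} → 0 < ⟦ e ⟧ σ →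
    W ⊢ p , σ ⇓ τ # s → W ⊢ While e Do p , τ ⇓ υ # t →
    W ⊢ While e Do p , σ ⇓ υ # suc (cost e + (s + t))

-- The i-th list is stored in array i; all other cells are 0.

nth : ∀ {A : Set} → A → List A → ℕ → A
nth d []       i       = d
nth d (x ∷ xs) zero    = x
nth d (x ∷ xs) (suc i) = nth d xs i

load : List (List ℕ) → Memory
load xss a i = nth 0 (nth [] xss a) i

-- The answer is left in cell 0 of array 0, nonzero meaning yes.

accepts : Memory → Bool
accepts σ = 0 <ᵇ σ 0 0

-- A promise problem is decided in linear time when one program is correct
-- and halts in time O(size) on all inputs satisfying the promise, using
-- words of O(log size) bits.  The `suc` and the 2 only serve inputs of
-- size 0 and 1.

LinearTimeDecidable : ∀ {Input : Set}
  (encode : Input → List (List ℕ)) (size : Input → ℕ)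
  (Promise Yes : Input → Set) → Set
LinearTimeDecidable {Input} encode size Promise Yes =
  Σ Program λ p → ∃[ c ] ∃[ k ] (∀ (x : Input) → Promise x →
    ∃[ τ ] ∃[ t ]
      ((2 + size x) ^ k ⊢ p , load (encode x) ⇓ τ # t
       × t ≤ c * suc (size x)
       × Reflects (Yes x) (accepts τ)))

------------------------------------------------------------------------
-- Instances of Token Sliding as inputs

graphSize : OrientedGraph → ℕ
graphSize G = order G + length (arcs G)

bit : Bool → ℕ
bit b = if b then 1 else 0

-- The numbers of vertices and of arcs, the tails and the heads of the
-- arcs, and the characteristic vectors of the two sets.
encodeInstance : Instance → List (List ℕ)
encodeInstance x =
    (order G ∷ length (arcs G) ∷ [])
  ∷ map (toℕ ∘ proj₁) (arcs G)
  ∷ map (toℕ ∘ proj₂) (arcs G)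
  ∷ map bit (toList (source x))
  ∷ map bit (toList (target x))
  ∷ []
  where G = graph x

-- A token can only slide from u to v if u is the only neighbour of v in the
-- current set I, so v lies in X(I), the set of vertices with at most one
-- neighbour in I.  In a cograph the slide does not change X: a vertex w of
-- X(I) with a second neighbour b after the slide would induce the path
-- u - v - w - b.  Hence T can be reached from S if and only if ∣S∣ = ∣T∣ and
-- every vertex of S has a directed walk to T inside X(S): conversely, moving
-- the tokens one after the other along their walks ends in a subset of T,
-- which is T by cardinality.  The program computes X(S) by counting
-- neighbours, marks by backward search from T inside X(S) the vertices that
-- have such a walk, and compares the cardinalities.

module Submission where

open import Defs
open import Data.Bool using (true; false; if_then_else_)
open import Data.Empty using (⊥; ⊥-elim)
open import Data.Fin using (Fin; toℕ; fromℕ; fromℕ<; inject₁)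
  renaming (zero to fzero; suc to fsuc; _≟_ to _≟ᶠ_)
open import Data.Fin.Properties using (any?; toℕ-injective; toℕ<n; toℕ-fromℕ<)
open import Data.Fin.Subset using (Subset; ⁅_⁆; _─_; _-_; _∪_; _∩_; ∣_∣; _⊆_; ⊤)
  renaming (_∈_ to _∈ₛ_; _∉_ to _∉ₛ_)
open import Data.Fin.Subset.Properties
  using (⊆-antisym; p⊂q⇒∣p∣<∣q∣; x∈⁅x⁆; x∈⁅y⁆⇒x≡y; ∣⁅x⁆∣≡1; p─q⊆p; x∈p∧x∉q⇒x∈p─q; ∩-comm;
         x∈p∪q⁺; x∈p∪q⁻; x∈p∧x≢y⇒x∈p-y; x∈p⇒∣p-x∣<∣p∣; ∈⊤)
  renaming (_∈?_ to _∈ₛ?_)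
open import Data.List using (List; []; _∷_; length; map)
open import Data.List.Membership.Propositional using (_∈_; _∉_)
import Data.List.Membership.DecPropositional as DecMembership
open import Data.List.Relation.Unary.All as All using (All; []; _∷_)
open import Data.List.Relation.Unary.AllPairs using ([]; _∷_)
open import Data.List.Relation.Unary.Any using (here; there)
open import Data.List.Relation.Unary.Unique.Propositional using (Unique)
open import Data.Nat
open import Data.Nat.ListAction using (sum)
open import Data.Nat.Properties
open import Data.Product using (Σ; ∃; ∃-syntax; _×_; _,_; proj₁; proj₂)
open import Data.Product.Properties using (≡-dec)
open import Data.Sum using (_⊎_; inj₁; inj₂; [_,_]′)
open import Data.Unit using (tt)
open import Data.Vec using ([]; _∷_; toList; here; there)
open import Function using (_∘_; case_of_)
open import Function.Bundles using (_⇔_; mk⇔)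
open import Relation.Binary using (Decidable)
open import Relation.Binary.PropositionalEquality
open import Relation.Nullary using (¬_; yes; no; Reflects)
open import Relation.Nullary.Decidable using (_⊎-dec_; _×-dec_; ¬?; decidable-stable)
open import Relation.Nullary.Reflects using (fromEquivalence)

-- Reconfiguration in cographs

-- No matching between S and T has to be chosen. The next vertex v of a walk is adjacent to the
-- moving token, so independence keeps v free of tokens; and v lies in X of the current set, so no
-- other token is adjacent to it. A walk therefore never collides with another token, and tokens
-- already on T can stay where they are. Linear time comes from an amortised count: every step of
-- the search either consumes an arc or pops a vertex that is never pushed again. So n + m steps
-- suffice, and one loop with a loop-free body can do them all.

∣p∩q∣+∣p─q∣≡∣p∣ : ∀ {n} (p q : Subset n) → ∣ p ∩ q ∣ + ∣ p ─ q ∣ ≡ ∣ p ∣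
∣p∩q∣+∣p─q∣≡∣p∣ []          []          = refl
∣p∩q∣+∣p─q∣≡∣p∣ (true  ∷ p) (true  ∷ q) = cong suc (∣p∩q∣+∣p─q∣≡∣p∣ p q)
∣p∩q∣+∣p─q∣≡∣p∣ (true  ∷ p) (false ∷ q) =
  trans (+-suc _ _) (cong suc (∣p∩q∣+∣p─q∣≡∣p∣ p q))
∣p∩q∣+∣p─q∣≡∣p∣ (false ∷ p) (true  ∷ q) = ∣p∩q∣+∣p─q∣≡∣p∣ p q
∣p∩q∣+∣p─q∣≡∣p∣ (false ∷ p) (false ∷ q) = ∣p∩q∣+∣p─q∣≡∣p∣ p q

x∈p─q⇒x∉q : ∀ {n} (p q : Subset n) {x} → x ∈ₛ p ─ q → x ∉ₛ q
x∈p─q⇒x∉q (true  ∷ p) (true  ∷ q) {fzero}  ()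
x∈p─q⇒x∉q (false ∷ p) (true  ∷ q) {fzero}  ()
x∈p─q⇒x∉q (_     ∷ p) (true  ∷ q) {fsuc x} (there i) (there j) = x∈p─q⇒x∉q p q i j
x∈p─q⇒x∉q (_     ∷ p) (false ∷ q) {fsuc x} (there i) (there j) = x∈p─q⇒x∉q p q i j

p⊆q∧∣p∣≡∣q∣⇒p≡q : ∀ {n} {p q : Subset n} → p ⊆ q → ∣ p ∣ ≡ ∣ q ∣ → p ≡ q
p⊆q∧∣p∣≡∣q∣⇒p≡q {p = p} {q} p⊆q eq = ⊆-antisym p⊆q λ {x} x∈q →
  decidable-stable (x ∈ₛ? p) λ x∉p →
    <-irrefl eq (p⊂q⇒∣p∣<∣q∣ (p⊆q , x , x∈q , x∉p))

module _ {n} (H : Graph n) where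
  open Graph H using (symm; irrefl)

  -- Distinctness of the four vertices follows from the six relations: identifying any two of them
  -- turns one of the edges into one of the non-edges.
  cograph-P₄ : IsCograph H → ∀ {a b c d} →
    Adj H a b → Adj H b c → Adj H c d →
    ¬ Adj H a c → ¬ Adj H b d → ¬ Adj H a d → ⊥
  cograph-P₄ cog {a} {b} {c} {d} ab bc cd ac bd ad = cog (f , inj , adj)
    where
    f : Fin 4 → Fin n
    f fzero                      = a
    f (fsuc fzero)               = b
    f (fsuc (fsuc fzero))        = c
    f (fsuc (fsuc (fsuc fzero))) = d

    0≢1 : a ≢ b
    0≢1 refl = ac bc
    0≢2 : a ≢ c
    0≢2 refl = ad cd
    0≢3 : a ≢ d
    0≢3 refl = ac (symm cd)
    1≢2 : b ≢ c
    1≢2 refl = bd cd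
    1≢3 : b ≢ d
    1≢3 refl = ad ab
    2≢3 : c ≢ d
    2≢3 refl = bd bc

    inj : ∀ {i j} → f i ≡ f j → i ≡ j
    inj {fzero} {fzero} eq = refl
    inj {fzero} {fsuc fzero} eq = ⊥-elim (0≢1 eq)
    inj {fzero} {fsuc (fsuc fzero)} eq = ⊥-elim (0≢2 eq)
    inj {fzero} {fsuc (fsuc (fsuc fzero))} eq = ⊥-elim (0≢3 eq)
    inj {fsuc fzero} {fzero} eq = ⊥-elim (0≢1 (sym eq))
    inj {fsuc fzero} {fsuc fzero} eq = refl
    inj {fsuc fzero} {fsuc (fsuc fzero)} eq = ⊥-elim (1≢2 eq)
    inj {fsuc fzero} {fsuc (fsuc (fsuc fzero))} eq = ⊥-elim (1≢3 eq)
    inj {fsuc (fsuc fzero)} {fzero} eq = ⊥-elim (0≢2 (sym eq))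
    inj {fsuc (fsuc fzero)} {fsuc fzero} eq = ⊥-elim (1≢2 (sym eq))
    inj {fsuc (fsuc fzero)} {fsuc (fsuc fzero)} eq = refl
    inj {fsuc (fsuc fzero)} {fsuc (fsuc (fsuc fzero))} eq = ⊥-elim (2≢3 eq)
    inj {fsuc (fsuc (fsuc fzero))} {fzero} eq = ⊥-elim (0≢3 (sym eq))
    inj {fsuc (fsuc (fsuc fzero))} {fsuc fzero} eq = ⊥-elim (1≢3 (sym eq))
    inj {fsuc (fsuc (fsuc fzero))} {fsuc (fsuc fzero)} eq = ⊥-elim (2≢3 (sym eq))
    inj {fsuc (fsuc (fsuc fzero))} {fsuc (fsuc (fsuc fzero))} eq = refl

    loop : ∀ {x} {A : Set} → Adj H x x → A
    loop xx = ⊥-elim (irrefl refl xx)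

    adj : ∀ i j → Adj (path 4) i j ⇔ Adj H (f i) (f j)
    adj fzero fzero = mk⇔ (λ { (inj₁ ()) ; (inj₂ ()) }) loop
    adj fzero (fsuc fzero) = mk⇔ (λ _ → ab) (λ _ → inj₁ refl)
    adj fzero (fsuc (fsuc fzero)) = mk⇔ (λ { (inj₁ ()) ; (inj₂ ()) }) (⊥-elim ∘ ac)
    adj fzero (fsuc (fsuc (fsuc fzero))) = mk⇔ (λ { (inj₁ ()) ; (inj₂ ()) }) (⊥-elim ∘ ad)
    adj (fsuc fzero) fzero = mk⇔ (λ _ → symm ab) (λ _ → inj₂ refl)
    adj (fsuc fzero) (fsuc fzero) = mk⇔ (λ { (inj₁ ()) ; (inj₂ ()) }) loop
    adj (fsuc fzero) (fsuc (fsuc fzero)) = mk⇔ (λ _ → bc) (λ _ → inj₁ refl)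
    adj (fsuc fzero) (fsuc (fsuc (fsuc fzero))) = mk⇔ (λ { (inj₁ ()) ; (inj₂ ()) }) (⊥-elim ∘ bd)
    adj (fsuc (fsuc fzero)) fzero = mk⇔ (λ { (inj₁ ()) ; (inj₂ ()) }) (⊥-elim ∘ ac ∘ symm)
    adj (fsuc (fsuc fzero)) (fsuc fzero) = mk⇔ (λ _ → symm bc) (λ _ → inj₂ refl)
    adj (fsuc (fsuc fzero)) (fsuc (fsuc fzero)) = mk⇔ (λ { (inj₁ ()) ; (inj₂ ()) }) loop
    adj (fsuc (fsuc fzero)) (fsuc (fsuc (fsuc fzero))) = mk⇔ (λ _ → cd) (λ _ → inj₁ refl)
    adj (fsuc (fsuc (fsuc fzero))) fzero = mk⇔ (λ { (inj₁ ()) ; (inj₂ ()) }) (⊥-elim ∘ ad ∘ symm)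
    adj (fsuc (fsuc (fsuc fzero))) (fsuc fzero) = mk⇔ (λ { (inj₁ ()) ; (inj₂ ()) }) (⊥-elim ∘ bd ∘ symm)
    adj (fsuc (fsuc (fsuc fzero))) (fsuc (fsuc fzero)) = mk⇔ (λ _ → symm cd) (λ _ → inj₂ refl)
    adj (fsuc (fsuc (fsuc fzero))) (fsuc (fsuc (fsuc fzero))) = mk⇔ (λ { (inj₁ ()) ; (inj₂ ()) }) loop

  AtMostOneNeighbour : Subset n → Fin n → Set
  AtMostOneNeighbour I w = ∀ a b → a ∈ₛ I → b ∈ₛ I → Adj H w a → Adj H w b → a ≡ b

-- Pointwise form of the two difference equations of `Slide`. It leaves out the arc and so is
-- symmetric, which allows the invariance of X to be applied backwards along a slide.
record Exchange {n} (I J : Subset n) (u v : Fin n) : Set where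
  field
    u∈I : u ∈ₛ I
    u∉J : u ∉ₛ J
    v∈J : v ∈ₛ J
    v∉I : v ∉ₛ I
    I⊆J : ∀ {x} → x ∈ₛ I → x ≢ u → x ∈ₛ J
    J⊆I : ∀ {x} → x ∈ₛ J → x ≢ v → x ∈ₛ I

open Exchange

exchange-sym : ∀ {n} {I J : Subset n} {u v} → Exchange I J u v → Exchange J I v u
exchange-sym e = record
  { u∈I = v∈J e ; u∉J = v∉I e ; v∈J = u∈I e ; v∉I = u∉J e ; I⊆J = J⊆I e ; J⊆I = I⊆J e }

difference-singleton : ∀ {n} {I J : Subset n} {u} → I ─ J ≡ ⁅ u ⁆ →
  u ∈ₛ I × u ∉ₛ J × (∀ {x} → x ∈ₛ I → x ≢ u → x ∈ₛ J)
difference-singleton {I = I} {J} {u} eq =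
  p─q⊆p I J u∈I─J , x∈p─q⇒x∉q I J u∈I─J , λ {x} x∈I x≢u →
    decidable-stable (x ∈ₛ? J) λ x∉J →
      x≢u (x∈⁅y⁆⇒x≡y u (subst (x ∈ₛ_) eq (x∈p∧x∉q⇒x∈p─q x∈I x∉J)))
  where
  u∈I─J : u ∈ₛ I ─ J
  u∈I─J = subst (u ∈ₛ_) (sym eq) (x∈⁅x⁆ u)

singleton-difference : ∀ {n} {I J : Subset n} {u} →
  u ∈ₛ I → u ∉ₛ J → (∀ {x} → x ∈ₛ I → x ≢ u → x ∈ₛ J) → I ─ J ≡ ⁅ u ⁆
singleton-difference {I = I} {J} {u} u∈I u∉J I⊆J = ⊆-antisym
  (λ {x} x∈I─J → case x ≟ᶠ u of λ where
    (yes refl) → x∈⁅x⁆ u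
    (no  x≢u)  → ⊥-elim (x∈p─q⇒x∉q I J x∈I─J (I⊆J (p─q⊆p I J x∈I─J) x≢u)))
  (λ x∈⁅u⁆ → subst (_∈ₛ I ─ J) (sym (x∈⁅y⁆⇒x≡y u x∈⁅u⁆)) (x∈p∧x∉q⇒x∈p─q u∈I u∉J))

exchange-card : ∀ {n} {I J : Subset n} {u v} → Exchange I J u v → ∣ I ∣ ≡ ∣ J ∣
exchange-card {I = I} {J} {u} {v} e = begin
  ∣ I ∣                     ≡⟨ ∣p∩q∣+∣p─q∣≡∣p∣ I J ⟨
  ∣ I ∩ J ∣ + ∣ I ─ J ∣     ≡⟨ cong₂ _+_ (cong ∣_∣ (∩-comm I J)) cards ⟩
  ∣ J ∩ I ∣ + ∣ J ─ I ∣     ≡⟨ ∣p∩q∣+∣p─q∣≡∣p∣ J I ⟩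
  ∣ J ∣                     ∎
  where
  open ≡-Reasoning
  cards : ∣ I ─ J ∣ ≡ ∣ J ─ I ∣
  cards = begin
    ∣ I ─ J ∣ ≡⟨ cong ∣_∣ (singleton-difference (u∈I e) (u∉J e) (I⊆J e)) ⟩
    ∣ ⁅ u ⁆ ∣ ≡⟨ ∣⁅x⁆∣≡1 u ⟩
    1         ≡⟨ ∣⁅x⁆∣≡1 v ⟨
    ∣ ⁅ v ⁆ ∣ ≡⟨ cong ∣_∣ (singleton-difference (v∈J e) (v∉I e) (J⊆I e)) ⟨
    ∣ J ─ I ∣ ∎

move : ∀ {n} → Subset n → Fin n → Fin n → Subset n
move I u v = (I - u) ∪ ⁅ v ⁆

move-exchange : ∀ {n} {I : Subset n} {u v} → u ∈ₛ I → v ∉ₛ I → Exchange I (move I u v) u v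
move-exchange {I = I} {u} {v} u∈I v∉I = record
  { u∈I = u∈I
  ; u∉J = λ u∈J → [ (λ u∈I-u → x∈p─q⇒x∉q I ⁅ u ⁆ u∈I-u (x∈⁅x⁆ u))
                  , (λ u∈⁅v⁆ → v∉I (subst (_∈ₛ I) (x∈⁅y⁆⇒x≡y v u∈⁅v⁆) u∈I)) ]′
                    (x∈p∪q⁻ (I - u) ⁅ v ⁆ u∈J)
  ; v∈J = x∈p∪q⁺ (inj₂ (x∈⁅x⁆ v))
  ; v∉I = v∉I
  ; I⊆J = λ x∈I x≢u → x∈p∪q⁺ (inj₁ (x∈p∧x≢y⇒x∈p-y x∈I x≢u))
  ; J⊆I = λ x∈J x≢v → [ p─q⊆p I ⁅ u ⁆ , (λ x∈⁅v⁆ → ⊥-elim (x≢v (x∈⁅y⁆⇒x≡y v x∈⁅v⁆))) ]′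
                        (x∈p∪q⁻ (I - u) ⁅ v ⁆ x∈J)
  }

module _ (G : OrientedGraph) where

  private
    H : Graph (order G)
    H = underlying G
  open Graph H using (symm; irrefl)

  arc? : Decidable (Arc G)
  arc? u v = DecMembership._∈?_ (≡-dec _≟ᶠ_ _≟ᶠ_) (u , v) (arcs G)

  adjacent? : Decidable (Adj H)
  adjacent? u v = arc? u v ⊎-dec arc? v u

  Slide⇒Exchange : ∀ {I J} ((u , v , _) : Slide G I J) → Exchange I J u v
  Slide⇒Exchange (u , v , _ , eqᵤ , eqᵥ)
    with u∈I , u∉J , I⊆J ← difference-singleton eqᵤ
       | v∈J , v∉I , J⊆I ← difference-singleton eqᵥ = record
    { u∈I = u∈I ; u∉J = u∉J ; v∈J = v∈J ; v∉I = v∉I ; I⊆J = I⊆J ; J⊆I = J⊆I }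

  Exchange⇒Slide : ∀ {I J u v} → Arc G u v → Exchange I J u v → Slide G I J
  Exchange⇒Slide {u = u} {v} uv e =
    u , v , uv , singleton-difference (u∈I e) (u∉J e) (I⊆J e)
               , singleton-difference (v∈J e) (v∉I e) (J⊆I e)

  stay : ∀ {I} → Independent H I → SlidingSequence G I I
  stay {I} ind = record
    { ℓ = 0 ; I = λ _ → I ; start = refl ; end = refl
    ; independent = λ _ → ind ; slides = λ () }

  slide-first : ∀ {I J K} → Independent H I → Slide G I J →
    SlidingSequence G J K → SlidingSequence G I K
  slide-first {I} {J} ind sl seq = record
    { ℓ = suc ℓ
    ; I = I′
    ; start = refl
    ; end = end
    ; independent = λ { fzero → ind ; (fsuc i) → independent i }
    ; slides = λ { fzero → subst (Slide G I) (sym start) sl ; (fsuc i) → slides i }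
    }
    where
    open SlidingSequence seq renaming (I to Is)
    I′ : Fin (suc (suc ℓ)) → VertexSet G
    I′ fzero    = I
    I′ (fsuc i) = Is i

  -- Otherwise u - v - w - b is an induced path.
  exchange-second-neighbour : IsCograph H → ∀ {I J u v} →
    Independent H I → Independent H J → Adj H u v → Exchange I J u v →
    ∀ {w} → AtMostOneNeighbour H I w → ∀ {b} → b ∈ₛ J → b ≢ v → Adj H w b → ¬ Adj H w v
  exchange-second-neighbour cog {J = J} {u} indI indJ uv e {w} one {b} b∈J b≢v wb wv
    with adjacent? w u
  ... | yes wu = u∉J e (subst (_∈ₛ J) (one b u (J⊆I e b∈J b≢v) (u∈I e) wb wu) b∈J)
  ... | no ¬wu = cograph-P₄ H cog uv (symm wv) wb (¬wu ∘ symm) (indJ (v∈J e) b∈J)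
                   (indI (u∈I e) (J⊆I e b∈J b≢v))

  exchange-AtMostOneNeighbour : IsCograph H → ∀ {I J u v} →
    Independent H I → Independent H J → Adj H u v → Exchange I J u v →
    ∀ {w} → AtMostOneNeighbour H I w → AtMostOneNeighbour H J w
  exchange-AtMostOneNeighbour cog {v = v} indI indJ uv e one a b a∈J b∈J wa wb
    with a ≟ᶠ v | b ≟ᶠ v
  ... | yes refl | yes refl = refl
  ... | no  a≢v  | no  b≢v  = one a b (J⊆I e a∈J a≢v) (J⊆I e b∈J b≢v) wa wb
  ... | yes refl | no  b≢v  =
    ⊥-elim (exchange-second-neighbour cog indI indJ uv e one b∈J b≢v wb wa)
  ... | no  a≢v  | yes refl =
    ⊥-elim (exchange-second-neighbour cog indI indJ uv e one a∈J a≢v wa wb)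

  -- Directed walks to the target and sliding sequences

  data Reaches (X : Fin (order G) → Set) (T : VertexSet G) : Fin (order G) → Set where
    here : ∀ {v} → v ∈ₛ T → X v → Reaches X T v
    step : ∀ {u v} → Arc G u v → X u → Reaches X T v → Reaches X T u

  reaches-map : ∀ {X Y T} → (∀ {w} → X w → Y w) → ∀ {v} → Reaches X T v → Reaches Y T v
  reaches-map f (here v∈T x)  = here v∈T (f x)
  reaches-map f (step uv x r) = step uv (f x) (reaches-map f r)

  independent⇒one : ∀ {I} → Independent H I → ∀ {v} → v ∈ₛ I → AtMostOneNeighbour H I v
  independent⇒one ind v∈I _ _ a∈I _ va _ = ⊥-elim (ind v∈I a∈I va)

  Feasible : VertexSet G → VertexSet G → Set
  Feasible S T = ∣ S ∣ ≡ ∣ T ∣ × (∀ {s} → s ∈ₛ S → Reaches (AtMostOneNeighbour H S) T s)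

  -- Induction on the length: the token that slides first puts one arc in front of the walk of its
  -- new position, and all others inherit their walks.
  sliding⇒feasible : IsCograph H → ∀ {S T} → SlidingSequence G S T → Feasible S T
  sliding⇒feasible cog seq = go ℓ I start end independent slides
    where
    open SlidingSequence seq
    go : ∀ {S T} ℓ (I : Fin (suc ℓ) → VertexSet G) → I fzero ≡ S → I (fromℕ ℓ) ≡ T →
      (∀ i → Independent H (I i)) →
      (∀ (i : Fin ℓ) → Slide G (I (inject₁ i)) (I (fsuc i))) → Feasible S T
    go zero    I refl refl ind sl =
      refl , λ s∈S → here s∈S (independent⇒one (ind fzero) s∈S)
    go {T = T} (suc ℓ) I refl end ind sl
      with u , v , uv , _ ← sl fzero | e ← Slide⇒Exchange (sl fzero)
         | card , reach ← go ℓ (I ∘ fsuc) refl end (ind ∘ fsuc) (sl ∘ fsuc) =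
      trans (exchange-card e) card , λ {s} s∈S → case s ≟ᶠ u of λ where
          (yes refl) → step uv (independent⇒one (ind fzero) s∈S) (reach′ (v∈J e))
          (no  s≢u)  → reach′ (I⊆J e s∈S s≢u)
      where
      reach′ : ∀ {s} → s ∈ₛ I (fsuc fzero) → Reaches (AtMostOneNeighbour H (I fzero)) T s
      -- The induction hypothesis yields walks inside X of the second set; invariance along the
      -- reversed exchange puts them inside X of the first.
      reach′ s∈J = reaches-map
        (exchange-AtMostOneNeighbour cog (ind (fsuc fzero)) (ind fzero) (inj₂ uv) (exchange-sym e))
        (reach s∈J)

  -- `todo` contains all tokens not on T, except the one being moved along its walk.
  feasible⇒sliding : IsCograph H → ∀ {S T} → Independent H S → Feasible S T → SlidingSequence G S T
  feasible⇒sliding cog {S₀} {T} ind₀ (card₀ , reach₀) =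
    finish ∣ ⊤ {order G} ∣ ⊤ ≤-refl (λ _ _ → ∈⊤) ind₀ card₀ (λ x → x) reach₀
    where
    X = AtMostOneNeighbour H S₀

    finish : ∀ {S} k todo → ∣ todo ∣ ≤ k → (∀ {x} → x ∈ₛ S → x ∉ₛ T → x ∈ₛ todo) →
      Independent H S → ∣ S ∣ ≡ ∣ T ∣ → (∀ {w} → X w → AtMostOneNeighbour H S w) →
      (∀ {s} → s ∈ₛ S → Reaches X T s) → SlidingSequence G S T
    advance : ∀ {S s} k todo → Reaches X T s → s ∈ₛ S → ∣ todo ∣ ≤ k →
      (∀ {x} → x ∈ₛ S → x ≢ s → x ∉ₛ T → x ∈ₛ todo) →
      Independent H S → ∣ S ∣ ≡ ∣ T ∣ → (∀ {w} → X w → AtMostOneNeighbour H S w) →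
      (∀ {s} → s ∈ₛ S → Reaches X T s) → SlidingSequence G S T

    finish {S} k todo ≤k rest ind card one reach
      with any? (λ s → (s ∈ₛ? S) ×-dec ¬? (s ∈ₛ? T))
    ... | no none = subst (SlidingSequence G S)
          -- No token is off T, so the current set is contained in T and has its cardinality.
          (p⊆q∧∣p∣≡∣q∣⇒p≡q (λ {x} x∈S → decidable-stable (x ∈ₛ? T) λ x∉T → none (x , x∈S , x∉T)) card)
          (stay ind)
    ... | yes (s , s∈S , s∉T) with k | ≤-trans (x∈p⇒∣p-x∣<∣p∣ (rest s∈S s∉T)) ≤k
    ... | suc k′ | s≤s ≤k′ = advance k′ (todo - s) (reach s∈S) s∈S ≤k′
          (λ x∈S x≢s x∉T → x∈p∧x≢y⇒x∈p-y (rest x∈S x∉T) x≢s) ind card one reach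

    advance {S} {s} k todo (here s∈T _) s∈S ≤k rest ind card one reach =
      finish k todo ≤k rest′ ind card one reach
      where
      rest′ : ∀ {x} → x ∈ₛ S → x ∉ₛ T → x ∈ₛ todo
      rest′ {x} x∈S x∉T = rest x∈S (λ { refl → x∉T s∈T }) x∉T
    advance {S} {s} k todo (step {v = v} sv _ r) s∈S ≤k rest ind card one reach =
      slide-first ind (Exchange⇒Slide sv e)
        (advance k todo r (v∈J e) ≤k
          (λ x∈J x≢v → rest (J⊆I e x∈J x≢v) λ { refl → u∉J e x∈J })
          ind′ (trans (sym (exchange-card e)) card)
          (λ x → exchange-AtMostOneNeighbour cog ind ind′ (inj₁ sv) e (one x))
          reach′)
      where
      e : Exchange S (move S s v) s v
      e = move-exchange s∈S (λ v∈S → ind s∈S v∈S (inj₁ sv))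

      xv : X v
      xv = case r of λ { (here _ x) → x ; (step _ x _) → x }

      v-isolated : ∀ {b} → b ∈ₛ S → b ≢ s → ¬ Adj H v b
      v-isolated b∈S b≢s vb = b≢s (one xv _ _ b∈S s∈S vb (inj₂ sv))

      ind′ : Independent H (move S s v)
      ind′ {a} {b} a∈J b∈J ab with a ≟ᶠ v | b ≟ᶠ v
      ... | yes refl | yes refl = irrefl refl ab
      ... | yes refl | no  b≢v  = v-isolated (J⊆I e b∈J b≢v) (λ { refl → u∉J e b∈J }) ab
      ... | no  a≢v  | yes refl = v-isolated (J⊆I e a∈J a≢v) (λ { refl → u∉J e a∈J }) (symm ab)
      ... | no  a≢v  | no  b≢v  = ind (J⊆I e a∈J a≢v) (J⊆I e b∈J b≢v) ab

      reach′ : ∀ {x} → x ∈ₛ move S s v → Reaches X T x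
      reach′ {x} x∈J = case x ≟ᶠ v of λ where
        (yes refl) → r
        (no  x≢v)  → reach (J⊆I e x∈J x≢v)

-- Running programs

-- `time p * z` bounds the running time of p if the bodies of the loops are
-- loop-free and each loop makes fewer than z iterations.
time : Program → ℕ
time skip                 = 1
time (a [ e ]:= f)        = suc (cost e + cost f)
time (p ⨾ q)              = time p + time q
time (If e Then p Else q) = suc (cost e + (time p ⊔ time q))
time (While e Do p)       = suc (cost e + time p)

record Runs (W z : ℕ) (p : Program) (σ : Memory) (Q : Memory → Set) : Set where
  constructor runs
  field
    {final} : Memory
    {steps} : ℕ
    halts   : W ⊢ p , σ ⇓ final # steps
    fast    : steps ≤ time p * z
    post    : Q final

runs-seq : ∀ {W z p q σ R Q} → Runs W z p σ R →
  (∀ τ → R τ → Runs W z q τ Q) → Runs W z (p ⨾ q) σ Q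
runs-seq {z = z} {p} {q} (runs p⇓ s≤ r) next with runs q⇓ t≤ post ← next _ r =
  runs (⇓-seq p⇓ q⇓)
    (≤-trans (+-mono-≤ s≤ t≤) (≤-reflexive (sym (*-distribʳ-+ z (time p) (time q))))) post

runs-map : ∀ {W z p σ Q R} → (∀ τ → Q τ → R τ) → Runs W z p σ Q → Runs W z p σ R
runs-map f (runs p⇓ t≤ post) = runs p⇓ t≤ (f _ post)

-- Weakest preconditions of loop-free programs.
WP : ℕ → Program → (Memory → Set) → Memory → Set
WP W skip                 Q σ = Q σ
WP W (a [ e ]:= f)        Q σ = ⟦ f ⟧ σ < W × Q (σ [ a ∙ ⟦ e ⟧ σ ≔ ⟦ f ⟧ σ ])
WP W (p ⨾ q)              Q σ = WP W p (WP W q Q) σ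
WP W (If e Then p Else q) Q σ = (0 < ⟦ e ⟧ σ → WP W p Q σ) × (⟦ e ⟧ σ ≡ 0 → WP W q Q σ)
WP W (While e Do p)       Q σ = ⊥

wp-sound : ∀ {W} p {Q σ} → WP W p Q σ → ∃[ τ ] ∃[ t ] (W ⊢ p , σ ⇓ τ # t × t ≤ time p × Q τ)
wp-sound skip          wp       = _ , _ , ⇓-skip , ≤-refl , wp
wp-sound (a [ e ]:= f) (b , wp) = _ , _ , ⇓-assign b , ≤-refl , wp
wp-sound (p ⨾ q)       wp
  with τ , s , p⇓ , s≤ , wq   ← wp-sound p wp
  with υ , t , q⇓ , t≤ , post ← wp-sound q wq = υ , s + t , ⇓-seq p⇓ q⇓ , +-mono-≤ s≤ t≤ , post
wp-sound (If e Then p Else q) {σ = σ} (wp , wq) with ⟦ e ⟧ σ in eq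
... | zero with τ , t , q⇓ , t≤ , post ← wp-sound q (wq refl) =
  τ , _ , ⇓-else eq q⇓ , s≤s (+-monoʳ-≤ (cost e) (m≤n⇒m≤o⊔n (time p) t≤)) , post
... | suc k with τ , t , p⇓ , t≤ , post ← wp-sound p (wp z<s) =
  τ , _ , ⇓-then (subst (0 <_) (sym eq) z<s) p⇓
    , s≤s (+-monoʳ-≤ (cost e) (m≤n⇒m≤n⊔o (time q) t≤)) , post

runs-assign : ∀ {W z a e f σ} {Q : Memory → Set} → 0 < z → ⟦ f ⟧ σ < W →
  Q (σ [ a ∙ ⟦ e ⟧ σ ≔ ⟦ f ⟧ σ ]) → Runs W z (a [ e ]:= f) σ Q
runs-assign {z = suc z} _ bound post = runs (⇓-assign bound) (m≤m*n _ (suc z)) post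

-- The index of `Inv` bounds the number of iterations left. Strictness of k < z pays for the last
-- evaluation of the guard, the one that fails.
runs-while : ∀ {W} e p (Inv : ℕ → Memory → Set) →
  (∀ k σ → Inv k σ → 0 < ⟦ e ⟧ σ → ∃[ k′ ] (k ≡ suc k′ × WP W p (Inv k′) σ)) →
  ∀ {z k} σ → k < z → Inv k σ →
  Runs W z (While e Do p) σ (λ τ → (∃[ k′ ] Inv k′ τ) × ⟦ e ⟧ τ ≡ 0)
runs-while e p Inv body {suc z} {k} σ k<z inv with ⟦ e ⟧ σ in eq
... | zero = runs (⇓-stop eq) (≤-trans (s≤s (m≤m+n (cost e) (time p))) (m≤m*n _ (suc z))) ((k , inv) , eq)
... | suc _ with body k σ inv (subst (0 <_) (sym eq) z<s)
... | k′ , refl , wp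
  with τ , s , p⇓ , s≤ , inv′ ← wp-sound p wp
  with runs {steps = t} q⇓ t≤ post ← runs-while e p Inv body τ (s≤s⁻¹ k<z) inv′ =
  runs (⇓-loop (subst (0 <_) (sym eq) z<s) p⇓ q⇓) (begin
      suc (cost e + (s + t))                           ≡⟨ cong suc (+-assoc (cost e) s t) ⟨
      suc (cost e + s) + t                             ≤⟨ +-mono-≤ (s≤s (+-monoʳ-≤ (cost e) s≤)) t≤ ⟩
      time (While e Do p) + time (While e Do p) * z    ≡⟨ *-suc (time (While e Do p)) z ⟨
      time (While e Do p) * suc z                      ∎)
    post
  where open ≤-Reasoning

-- Arrays and sums

upd : (ℕ → ℕ) → ℕ → ℕ → ℕ → ℕ
upd f i v j = if i ≡ᵇ j then v else f j

module _ {A : Set} {x y : A} where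

  if-≡ : ∀ {i j} → i ≡ j → (if i ≡ᵇ j then x else y) ≡ x
  if-≡ {i} {j} i≡j with i ≡ᵇ j | ≡⇒≡ᵇ i j i≡j
  ... | true | _ = refl

  if-≢ : ∀ {i j} → i ≢ j → (if i ≡ᵇ j then x else y) ≡ y
  if-≢ {i} {j} i≢j with i ≡ᵇ j | ≡ᵇ⇒≡ i j
  ... | true  | f = ⊥-elim (i≢j (f tt))
  ... | false | _ = refl

sumTo : ℕ → (ℕ → ℕ) → ℕ
sumTo zero    f = 0
sumTo (suc k) f = sumTo k f + f k

sumTo-cong : ∀ k {f g : ℕ → ℕ} → (∀ i → i < k → f i ≡ g i) → sumTo k f ≡ sumTo k g
sumTo-cong zero    eq = refl
sumTo-cong (suc k) eq =
  cong₂ _+_ (sumTo-cong k λ i i<k → eq i (m<n⇒m<1+n i<k)) (eq k ≤-refl)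

sumTo-≤ : ∀ k b {f : ℕ → ℕ} → (∀ i → i < k → f i ≤ b) → sumTo k f ≤ k * b
sumTo-≤ zero    b f≤ = z≤n
sumTo-≤ (suc k) b {f} f≤ = ≤-trans (≤-reflexive (+-comm (sumTo k f) (f k)))
  (+-mono-≤ (f≤ k ≤-refl) (sumTo-≤ k b λ i i<k → f≤ i (m<n⇒m<1+n i<k)))

sumTo-≡0 : ∀ k {f : ℕ → ℕ} → sumTo k f ≡ 0 → ∀ i → i < k → f i ≡ 0
sumTo-≡0 (suc k) {f} eq i i<1+k with m≤n⇒m<n∨m≡n (s≤s⁻¹ i<1+k)
... | inj₁ i<k  = sumTo-≡0 k (m+n≡0⇒m≡0 (sumTo k f) eq) i i<k
... | inj₂ refl = m+n≡0⇒n≡0 (sumTo k f) eq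

sumTo-const : ∀ k c → sumTo k (λ _ → c) ≡ k * c
sumTo-const zero    c = refl
sumTo-const (suc k) c = trans (+-comm (sumTo k (λ _ → c)) c) (cong (c +_) (sumTo-const k c))

-- The source of all amortised counts below: marking a vertex, or adding or removing an arc of a
-- list, changes a sum by one through a single index.
sumTo-suc : ∀ k {u} {f g : ℕ → ℕ} → u < k → f u ≡ suc (g u) →
  (∀ i → i ≢ u → f i ≡ g i) → sumTo k f ≡ suc (sumTo k g)
sumTo-suc (suc k) {u} {f} {g} u<1+k fu other with m≤n⇒m<n∨m≡n (s≤s⁻¹ u<1+k)
... | inj₁ u<k  = cong₂ _+_ (sumTo-suc k u<k fu other) (other k (>⇒≢ u<k))
... | inj₂ refl = trans (cong₂ _+_ (sumTo-cong k λ i i<k → other i (<⇒≢ i<k)) fu)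
                    (+-suc (sumTo k g) (g k))

-- Linked lists

-- A link is 0 at the end of a list and suc i at the cell i.
data Chain (next : ℕ → ℕ) : ℕ → List ℕ → Set where
  []  : Chain next 0 []
  _∷_ : ∀ i {is} → Chain next (next i) is → Chain next (suc i) (i ∷ is)

-- The list passes only through cells below j, so it never reads the cell that is overwritten.
chain-upd : ∀ {next j x l is} → All (_< j) is → Chain next l is → Chain (upd next j x) l is
chain-upd []          []      = []
chain-upd {next} {j} (i<j ∷ <j) (i ∷ c) =
  i ∷ subst (λ l → Chain _ l _) (sym (if-≢ (>⇒≢ i<j))) (chain-upd <j c)

chain-bound : ∀ {next l is b} → All (_< b) is → Chain next l is → l ≤ b
chain-bound []        []      = z≤n
chain-bound (i<b ∷ _) (i ∷ _) = i<b

updᴸ : (ℕ → List ℕ) → ℕ → List ℕ → ℕ → List ℕ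
updᴸ f i v j = if i ≡ᵇ j then v else f j

remaining : ∀ {k i b} → k + i ≡ b → b ∸ i ≡ k
remaining {k} {i} refl = m+n∸n≡m k i

-- A truncated difference that vanishes gives only a ≤ i; the invariant k + i ≡ b excludes
-- overshooting.
finished : ∀ {k i a b} → a ≡ b → k + i ≡ b → a ∸ i ≡ 0 → i ≡ b
finished {i = i} refl k+i≡b a∸i≡0 =
  trans (cong (_+ i) (trans (sym a∸i≡0) (remaining k+i≡b))) k+i≡b

-- The program

-- Arrays 0 to 4 are the input.  Array 5 marks the vertices found, 6 is the
-- stack of the search and 7 its height, 8 counts the neighbours in the source,
-- 9 and 10 hold the linked lists of the arcs entering each vertex.  Arrays 11
-- to 18 are scalars; 16 and 17 are the two cardinalities, and 18 counts the
-- source vertices without a mark.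

pattern at! a = a at lit 0

visit countArc countArcs seedVertex seed searchStep search checkVertex check solver : Program

visit =
  -- A conjunction by truncated subtraction: nonzero exactly when the vertex is unmarked and its
  -- neighbour count is at most 1.
  If lit 1 ⊖ (5 at at! 14 ⊕ (8 at at! 14 ⊖ lit 1)) Then
    5 [ at! 14 ]:= lit 1 ⨾
    6 [ at! 7 ]:= at! 14 ⨾
    7 [ lit 0 ]:= lit 1 ⊕ at! 7
  Else skip

countArc =
  8 [ 1 at at! 11 ]:= 8 at (1 at at! 11) ⊕ 3 at (2 at at! 11) ⨾
  8 [ 2 at at! 11 ]:= 8 at (2 at at! 11) ⊕ 3 at (1 at at! 11) ⨾
  -- Prepends the arc to the list of its head. As links are shifted by one, the zeros of the initial
  -- memory already represent empty lists.
  10 [ at! 11 ]:= 9 at (2 at at! 11) ⨾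
  9 [ 2 at at! 11 ]:= lit 1 ⊕ at! 11 ⨾
  11 [ lit 0 ]:= lit 1 ⊕ at! 11

countArcs = While 0 at lit 1 ⊖ at! 11 Do countArc

seedVertex =
  (If 4 at at! 12 Then 14 [ lit 0 ]:= at! 12 ⨾ visit Else skip) ⨾
  12 [ lit 0 ]:= lit 1 ⊕ at! 12

seed =
  -- Clearing these cells spares the invariant of the counting loop from tracking them.
  12 [ lit 0 ]:= lit 0 ⨾
  7 [ lit 0 ]:= lit 0 ⨾
  (While at! 0 ⊖ at! 12 Do seedVertex)

searchStep =
  13 [ lit 0 ]:= 6 at (at! 7 ⊖ lit 1) ⨾
  -- Each step handles one arc entering the top of the stack, or pops the top once its list is
  -- exhausted; this replaces a nested loop over the list.
  (If 9 at at! 13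
   Then 14 [ lit 0 ]:= 1 at (9 at at! 13 ⊖ lit 1) ⨾
        visit ⨾
        9 [ at! 13 ]:= 10 at (9 at at! 13 ⊖ lit 1)
   Else (7 [ lit 0 ]:= at! 7 ⊖ lit 1))

search = While at! 7 Do searchStep

checkVertex =
  16 [ lit 0 ]:= at! 16 ⊕ 3 at at! 15 ⨾
  17 [ lit 0 ]:= at! 17 ⊕ 4 at at! 15 ⨾
  18 [ lit 0 ]:= at! 18 ⊕ (3 at at! 15 ⊖ 5 at at! 15) ⨾
  15 [ lit 0 ]:= lit 1 ⊕ at! 15

check =
  15 [ lit 0 ]:= lit 0 ⨾
  16 [ lit 0 ]:= lit 0 ⨾
  17 [ lit 0 ]:= lit 0 ⨾
  18 [ lit 0 ]:= lit 0 ⨾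
  (While at! 0 ⊖ at! 15 Do checkVertex)

solver =
  countArcs ⨾ seed ⨾ search ⨾ check ⨾
  -- One of the two truncated differences is always 0, and both are exactly when the cardinalities
  -- agree.
  0 [ lit 0 ]:= lit 1 ⊖ (at! 18 ⊕ (at! 16 ⊖ at! 17) ⊕ (at! 17 ⊖ at! 16))

-- Correctness and running time

module Verification (n m : ℕ) (tl hd s t : ℕ → ℕ)
  (tl<n : ∀ {j} → j < m → tl j < n) (hd<n : ∀ {j} → j < m → hd j < n)
  (s≤1 : ∀ v → s v ≤ 1) (t≤1 : ∀ v → t v ≤ 1)
  (W : ℕ) (1<W : 1 < W) (n<W : n < W) (2m<W : m * 2 < W) where

  -- What `countArc` adds to the counter of w for the arc j. For arbitrary arrays this counts with
  -- multiplicity; that more than one unit means more than one neighbour is shown in `many-shares`.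
  incidence : ℕ → ℕ → ℕ
  incidence w j = (if tl j ≡ᵇ w then s (hd j) else 0) + (if hd j ≡ᵇ w then s (tl j) else 0)

  degree : ℕ → ℕ → ℕ
  degree j w = sumTo j (incidence w)

  Light : ℕ → Set
  Light w = degree m w ≤ 1

  data Coreachable : ℕ → Set where
    base : ∀ {v} → v < n → 0 < t v → Light v → Coreachable v
    step : ∀ {j} → j < m → Light (tl j) → Coreachable (hd j) → Coreachable (tl j)

  Input : (a₀ a₁ a₂ a₃ a₄ : ℕ → ℕ) → Set
  Input a₀ a₁ a₂ a₃ a₄ = a₀ 0 ≡ n × a₀ 1 ≡ m × a₁ ≗ tl × a₂ ≗ hd × a₃ ≗ s × a₄ ≗ t

  InputOf : Memory → Set
  InputOf σ = Input (σ 0) (σ 1) (σ 2) (σ 3) (σ 4)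

  if-≤ : ∀ b {x c} → x ≤ c → (if b then x else 0) ≤ c
  if-≤ true  x≤ = x≤
  if-≤ false x≤ = z≤n

  -- Counting neighbours and listing the entering arcs

  incidence≤2 : ∀ w j → incidence w j ≤ 2
  incidence≤2 w j = +-mono-≤ (if-≤ (tl j ≡ᵇ w) (s≤1 (hd j))) (if-≤ (hd j ≡ᵇ w) (s≤1 (tl j)))

  degree<W : ∀ {j} → j ≤ m → ∀ w → degree j w < W
  degree<W {j} j≤m w = ≤-<-trans (sumTo-≤ j 2 λ i _ → incidence≤2 w i)
    (≤-<-trans (*-monoˡ-≤ 2 j≤m) 2m<W)

  -- With an update written as the addition of an indicator, the two updates for the ends of an arc
  -- compose without comparing the ends.
  bump : ∀ f i a j → upd f i (f i + a) j ≡ f j + (if i ≡ᵇ j then a else 0)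
  bump f i a j with i ≟ j
  ... | yes refl = trans (if-≡ {i = i} refl) (cong (f i +_) (sym (if-≡ {i = i} refl)))
  ... | no  i≢j  = trans (if-≢ i≢j) (trans (sym (+-identityʳ (f j))) (cong (f j +_) (sym (if-≢ i≢j))))

  -- `lists` is ghost data: the memory holds only the links. `total` becomes the share of the arcs
  -- in the bound n + m on the search.
  record Counted (j : ℕ) (count first next : ℕ → ℕ) : Set where
    field
      counts   : ∀ w → count w ≡ degree j w
      lists    : ℕ → List ℕ
      chains   : ∀ v → Chain next (first v) (lists v)
      entering : ∀ v → All (λ i → i < j × hd i ≡ v) (lists v)
      complete : ∀ i → i < j → i ∈ lists (hd i)
      total    : sumTo n (length ∘ lists) ≡ j

  counted-zero : ∀ {count first next} → (∀ w → count w ≡ 0) → (∀ v → first v ≡ 0) →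
    Counted 0 count first next
  counted-zero count≡0 first≡0 = record
    { counts   = count≡0
    ; lists    = λ _ → []
    ; chains   = λ v → subst (λ l → Chain _ l []) (sym (first≡0 v)) []
    ; entering = λ _ → []
    ; complete = λ _ ()
    ; total    = trans (sumTo-const n 0) (*-zeroʳ n)
    }

  module _ {j count first next} (j<m : j < m) (I : Counted j count first next) where
    open Counted I

    private
      count₁ count₂ : ℕ → ℕ
      count₁ = upd count (tl j) (count (tl j) + s (hd j))
      count₂ = upd count₁ (hd j) (count₁ (hd j) + s (tl j))

    half-count : ∀ w → count₁ w ≡ degree j w + (if tl j ≡ᵇ w then s (hd j) else 0)
    half-count w = trans (bump count (tl j) (s (hd j)) w) (cong (_+ _) (counts w))

    full-count : ∀ w → count₂ w ≡ degree (suc j) w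
    full-count w = trans (bump count₁ (hd j) (s (tl j)) w)
      (trans (cong (_+ _) (half-count w)) (+-assoc (degree j w) _ _))

    -- The counter only grows, so its value between the two updates is at most its value after them,
    -- which is a degree.
    half-count<W : count (tl j) + s (hd j) < W
    half-count<W = subst (_< W) (if-≡ {i = tl j} refl)
      (≤-<-trans (≤-trans (m≤m+n (count₁ (tl j)) (if hd j ≡ᵇ tl j then s (tl j) else 0))
                   (≤-reflexive (trans (sym (bump count₁ (hd j) (s (tl j)) (tl j))) (full-count (tl j)))))
        (degree<W j<m (tl j)))

    full-count<W : count₁ (hd j) + s (tl j) < W
    full-count<W = subst (_< W) (trans (sym (full-count (hd j))) (if-≡ {i = hd j} refl))
      (degree<W j<m (hd j))

    first<W : first (hd j) < W
    first<W = ≤-<-trans (chain-bound (All.map proj₁ (entering (hd j))) (chains (hd j)))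
      (<-≤-trans j<m (≤-trans (m≤m*n m 2) (<⇒≤ 2m<W)))

    counted-suc : Counted (suc j) count₂ (upd first (hd j) (suc j)) (upd next j (first (hd j)))
    counted-suc = record
      { counts   = full-count
      ; lists    = lists′
      ; chains   = chains′
      ; entering = entering′
      ; complete = complete′
      ; total    = trans (sumTo-suc n (hd<n j<m) (cong length (if-≡ {i = hd j} refl))
                     (λ v v≢ → cong length (if-≢ (v≢ ∘ sym)))) (cong suc total)
      }
      where
      lists′ : ℕ → List ℕ
      lists′ = updᴸ lists (hd j) (j ∷ lists (hd j))

      old : ∀ v → Chain (upd next j (first (hd j))) (first v) (lists v)
      old v = chain-upd (All.map proj₁ (entering v)) (chains v)

      older : ∀ v → All (λ i → i < suc j × hd i ≡ v) (lists v)
      older v = All.map (λ (i<j , eq) → m<n⇒m<1+n i<j , eq) (entering v)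

      chains′ : ∀ v → Chain (upd next j (first (hd j))) (upd first (hd j) (suc j) v) (lists′ v)
      chains′ v with hd j ≟ v
      ... | yes refl = subst₂ (Chain _) (sym (if-≡ {i = hd j} refl)) (sym (if-≡ {i = hd j} refl))
            (j ∷ subst (λ l → Chain (upd next j (first (hd j))) l (lists (hd j)))
                   (sym (if-≡ {i = j} refl)) (old (hd j)))
      ... | no  ≢v = subst₂ (Chain _) (sym (if-≢ ≢v)) (sym (if-≢ ≢v)) (old v)

      entering′ : ∀ v → All (λ i → i < suc j × hd i ≡ v) (lists′ v)
      entering′ v with hd j ≟ v
      ... | yes refl = subst (All _) (sym (if-≡ {i = hd j} refl)) ((≤-refl , refl) ∷ older (hd j))
      ... | no  ≢v = subst (All _) (sym (if-≢ ≢v)) (older v)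

      complete′ : ∀ i → i < suc j → i ∈ lists′ (hd i)
      complete′ i i<1+j with m≤n⇒m<n∨m≡n (s≤s⁻¹ i<1+j)
      ... | inj₂ refl = subst (i ∈_) (sym (if-≡ {i = hd i} refl)) (here refl)
      ... | inj₁ i<j with hd j ≟ hd i
      ...   | yes eq = subst (i ∈_) (sym (if-≡ eq)) (there (subst (λ v → i ∈ lists v) (sym eq) (complete i i<j)))
      ...   | no  ≢  = subst (i ∈_) (sym (if-≢ ≢)) (complete i i<j)

  Counting : ℕ → Memory → Set
  Counting k σ = InputOf σ × (∀ v → σ 5 v ≡ 0) × k + σ 11 0 ≡ m × Counted (σ 11 0) (σ 8) (σ 9) (σ 10)

  -- The weakest precondition speaks of memory cells. Abstracting the values read as u, v, a, b
  -- makes the conclusion match it by computation.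
  counted-step : ∀ {j count first next} → j < m → Counted j count first next →
    ∀ {u v a b} → u ≡ tl j → v ≡ hd j → a ≡ s v → b ≡ s u →
    let count₁ = upd count u (count u + a) in
    count u + a < W × count₁ v + b < W × first v < W × suc j < W ×
    Counted (suc j) (upd count₁ v (count₁ v + b)) (upd first v (suc j)) (upd next j (first v))
  counted-step j<m I refl refl refl refl =
    half-count<W j<m I , full-count<W j<m I , first<W j<m I ,
    ≤-<-trans (≤-trans j<m (m≤m*n m 2)) 2m<W , counted-suc j<m I

  countArc-WP : ∀ k σ → Counting k σ → 0 < σ 0 1 ∸ σ 11 0 →
    ∃[ k′ ] (k ≡ suc k′ × WP W countArc (Counting k′) σ)
  countArc-WP zero σ ((_ , eqm , _) , _ , k+j≡m , _) 0< =
    ⊥-elim (<⇒≢ 0< (sym (trans (cong (_∸ σ 11 0) eqm) (remaining k+j≡m))))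
  countArc-WP (suc k) σ (inp@(_ , _ , eq₁ , eq₂ , eq₃ , _) , mark≡0 , k+j≡m , I) 0<
    with b₁ , b₂ , b₃ , b₄ , I′ ← counted-step (subst (σ 11 0 <_) k+j≡m (s≤s (m≤n+m (σ 11 0) k))) I
           (eq₁ (σ 11 0)) (eq₂ (σ 11 0)) (eq₃ (σ 2 (σ 11 0))) (eq₃ (σ 1 (σ 11 0))) =
    k , refl , b₁ , b₂ , b₃ , b₄ , b₄ , inp , mark≡0 , trans (+-suc k (σ 11 0)) k+j≡m , I′

  -- The search consumes the linked lists: `lists` are what is left of them,
  -- and i is the number of vertices examined as possible starting points.
  record Searching (lists : ℕ → List ℕ) (p i : ℕ) (next mark stack : ℕ → ℕ) (height : ℕ)
                   (first : ℕ → ℕ) : Set where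
    field
      chains    : ∀ v → Chain next (first v) (lists v)
      entering  : ∀ v → All (λ j → j < m × hd j ≡ v) (lists v)
      potential : height + sumTo n (λ v → 1 ∸ mark v) ≡ p
      stacked   : ∀ k → k < height → stack k < n × 0 < mark (stack k)
      sound     : ∀ v → 0 < mark v → Coreachable v
      seeded    : ∀ v → v < i → 0 < t v → Light v → 0 < mark v
      relaxed   : ∀ j → j < m → Light (tl j) → 0 < mark (tl j) ⊎ j ∈ lists (hd j)
      pending   : ∀ v → 0 < mark v → (∃[ k ] (k < height × stack k ≡ v)) ⊎ lists v ≡ []

  module _ {lists p i next mark stack height first}
           (I : Searching lists p i next mark stack height first) where
    open Searching I

    -- The potential is preserved: the stack gains the vertex that the unmarked ones lose.
    push : ∀ {u} → u < n → mark u ≡ 0 → Coreachable u →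
      Searching lists p i next (upd mark u 1) (upd stack height u) (suc height) first
    push {u} u<n unmarked reach = record
      { chains = chains
      ; entering = entering
      ; potential = trans (sym (+-suc height _))
          (trans (cong (height +_) (sym (sumTo-suc n u<n
             (trans (cong (1 ∸_) unmarked) (cong (λ x → suc (1 ∸ x)) (sym mark-u)))
             (λ v v≢u → cong (1 ∸_) (sym (if-≢ (v≢u ∘ sym)))))))
             potential)
      ; stacked = stacked′
      ; sound = sound′
      ; seeded = λ v v<i tv light → still (seeded v v<i tv light)
      ; relaxed = λ j j<m light → [ inj₁ ∘ still , inj₂ ]′ (relaxed j j<m light)
      ; pending = pending′
      }
      where
      mark-u : upd mark u 1 u ≡ 1
      mark-u = if-≡ {i = u} refl

      still : ∀ {v} → 0 < mark v → 0 < upd mark u 1 v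
      still {v} mv with u ≟ v
      ... | yes u≡v = subst (0 <_) (sym (if-≡ u≡v)) (s≤s z≤n)
      ... | no  u≢v = subst (0 <_) (sym (if-≢ u≢v)) mv

      stacked′ : ∀ k → k < suc height →
        upd stack height u k < n × 0 < upd mark u 1 (upd stack height u k)
      stacked′ k k<1+h with m≤n⇒m<n∨m≡n (s≤s⁻¹ k<1+h)
      ... | inj₁ k<h  rewrite if-≢ {x = u} {stack k} (>⇒≢ k<h) =
        proj₁ (stacked k k<h) , still (proj₂ (stacked k k<h))
      ... | inj₂ refl rewrite if-≡ {x = u} {stack k} {k} refl =
        u<n , subst (0 <_) (sym mark-u) (s≤s z≤n)

      sound′ : ∀ v → 0 < upd mark u 1 v → Coreachable v
      sound′ v mv with u ≟ v
      ... | yes refl = reach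
      ... | no  u≢v  = sound v (subst (0 <_) (if-≢ u≢v) mv)

      pending′ : ∀ v → 0 < upd mark u 1 v →
        (∃[ k ] (k < suc height × upd stack height u k ≡ v)) ⊎ lists v ≡ []
      pending′ v mv with u ≟ v
      ... | yes refl = inj₁ (height , ≤-refl , if-≡ {i = height} refl)
      ... | no  u≢v with pending v (subst (0 <_) (if-≢ u≢v) mv)
      ...   | inj₁ (k , k<h , eq) = inj₁ (k , m<n⇒m<1+n k<h , trans (if-≢ (>⇒≢ k<h)) eq)
      ...   | inj₂ empty          = inj₂ empty

    seed-next : (0 < t i → Light i → 0 < mark i) →
      Searching lists p (suc i) next mark stack height first
    seed-next marked = record
      { chains = chains ; entering = entering ; potential = potential ; stacked = stacked
      ; sound = sound ; relaxed = relaxed ; pending = pending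
      ; seeded = λ v v<1+i tv light → [ (λ v<i → seeded v v<i tv light) , (λ { refl → marked tv light }) ]′
          (m≤n⇒m<n∨m≡n (s≤s⁻¹ v<1+i))
      }

    nonempty : ∀ v → 0 < first v → ∃[ j ] ∃[ js ] lists v ≡ j ∷ js
    nonempty v 0<first with first v | lists v | chains v
    ... | _ | _ | []    = ⊥-elim (n≮0 0<first)
    ... | _ | _ | j ∷ c = j , _ , refl

    first-arc : ∀ {v j js} → lists v ≡ j ∷ js →
      first v ≡ suc j × Chain next (next j) js × next j ≤ m × j < m × hd j ≡ v
    first-arc {v} eq
      with first v | subst (Chain next (first v)) eq (chains v) | subst (All _) eq (entering v)
    ... | _ | j ∷ c | (j<m , hd≡v) ∷ rest =
      refl , c , chain-bound (All.map proj₁ rest) c , j<m , hd≡v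

    -- The arc may leave its list because its tail, if light, is already marked: `relaxed` switches
    -- to its first alternative.
    drop-arc : ∀ {v j js} → lists v ≡ j ∷ js → (Light (tl j) → 0 < mark (tl j)) →
      Searching (updᴸ lists v js) p i next mark stack height (upd first v (next (first v ∸ 1)))
    drop-arc {v} {j} {js} eq visited = record
      { chains = chains′ ; entering = entering′ ; potential = potential ; stacked = stacked
      ; sound = sound ; seeded = seeded ; relaxed = relaxed′ ; pending = pending′ }
      where
      chains′ : ∀ w → Chain next (upd first v (next (first v ∸ 1)) w) (updᴸ lists v js w)
      chains′ w with v ≟ w
      ... | no  v≢w  = subst₂ (Chain next) (sym (if-≢ v≢w)) (sym (if-≢ v≢w)) (chains w)
      ... | yes refl with first≡ , c , _ ← first-arc eq =
        subst₂ (Chain next) (trans (sym (cong (λ l → next (l ∸ 1)) first≡)) (sym (if-≡ {i = v} refl)))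
          (sym (if-≡ {i = v} refl)) c

      entering′ : ∀ w → All (λ j → j < m × hd j ≡ w) (updᴸ lists v js w)
      entering′ w with v ≟ w
      ... | no  v≢w  = subst (All _) (sym (if-≢ v≢w)) (entering w)
      ... | yes refl = subst (All _) (sym (if-≡ {i = v} refl)) (All.tail (subst (All _) eq (entering v)))

      relaxed′ : ∀ k → k < m → Light (tl k) → 0 < mark (tl k) ⊎ k ∈ updᴸ lists v js (hd k)
      relaxed′ k k<m light with relaxed k k<m light
      ... | inj₁ mk = inj₁ mk
      ... | inj₂ k∈ with v ≟ hd k
      ...   | no  v≢  = inj₂ (subst (k ∈_) (sym (if-≢ v≢)) k∈)
      ...   | yes v≡ with subst (k ∈_) (trans (cong lists (sym v≡)) eq) k∈
      ...     | here refl  = inj₁ (visited light)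
      ...     | there k∈js = inj₂ (subst (k ∈_) (sym (if-≡ v≡)) k∈js)

      pending′ : ∀ w → 0 < mark w → (∃[ k ] (k < height × stack k ≡ w)) ⊎ updᴸ lists v js w ≡ []
      pending′ w mw with pending w mw
      ... | inj₁ in-stack = inj₁ in-stack
      ... | inj₂ empty with v ≟ w
      ...   | no  v≢w  = inj₂ (trans (if-≢ v≢w) empty)
      ...   | yes refl with () ← trans (sym eq) empty

    -- With an empty stack, `pending` leaves no unread arc into a marked vertex, so `relaxed` makes
    -- the marks closed under light predecessors; `seeded` starts the induction along the walk.
    all-visited : height ≡ 0 → ∀ {v} → Coreachable v → i ≡ n → 0 < mark v
    all-visited h≡0 (base {v} v<n tv light) i≡n = seeded v (subst (v <_) (sym i≡n) v<n) tv light
    all-visited h≡0 (step {j} j<m light r) i≡n with relaxed j j<m light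
    ... | inj₁ mj = mj
    ... | inj₂ j∈ with pending (hd j) (all-visited h≡0 r i≡n)
    ...   | inj₁ (k , k<h , _) = ⊥-elim (n≮0 (subst (k <_) h≡0 k<h))
    ...   | inj₂ empty with () ← subst (j ∈_) empty j∈

    top : 0 < height → stack (height ∸ 1) < n × Coreachable (stack (height ∸ 1))
    top 0<h with v<n , marked ← stacked (height ∸ 1) (∸-monoʳ-< {height} (s≤s z≤n) 0<h) =
      v<n , sound _ marked

  -- The list of the top vertex is exhausted, so `pending` holds for it by the second alternative.
  -- Only here does the potential drop.
  pop : ∀ {lists p i next mark stack height first} →
    Searching lists p i next mark stack height first → 0 < height → first (stack (height ∸ 1)) ≡ 0 →
    ∃[ p′ ] (p ≡ suc p′ × Searching lists p′ i next mark stack (height ∸ 1) first)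
  pop {lists} {p} {mark = mark} {stack} {suc h} I _ first≡0 = _ , sym potential , record
    { chains = chains ; entering = entering ; potential = refl
    ; stacked = λ k k<h → stacked k (m<n⇒m<1+n k<h)
    ; sound = sound ; seeded = seeded ; relaxed = relaxed ; pending = pending′ }
    where
    open Searching I
    empty : lists (stack h) ≡ []
    empty with lists (stack h) | subst (λ l → Chain _ l (lists (stack h))) first≡0 (chains (stack h))
    ... | [] | [] = refl

    pending′ : ∀ v → 0 < mark v → (∃[ k ] (k < h × stack k ≡ v)) ⊎ lists v ≡ []
    pending′ v mv with pending v mv
    ... | inj₂ e = inj₂ e
    ... | inj₁ (k , k<1+h , eq) with m≤n⇒m<n∨m≡n (s≤s⁻¹ k<1+h)
    ...   | inj₁ k<h  = inj₁ (k , k<h , eq)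
    ...   | inj₂ refl = inj₂ (trans (cong lists (sym eq)) empty)

  counted⇒searching : ∀ {count first next mark stack} → (∀ v → mark v ≡ 0) →
    (I : Counted m count first next) →
    Searching (Counted.lists I) n 0 next mark stack 0 first
  counted⇒searching mark≡0 I = record
    { chains = chains ; entering = entering
    ; potential = trans (sumTo-cong n λ v _ → cong (1 ∸_) (mark≡0 v))
                    (trans (sumTo-const n 1) (*-identityʳ n))
    ; stacked = λ _ () ; sound = λ v mv → ⊥-elim (<⇒≢ mv (sym (mark≡0 v)))
    ; seeded = λ _ () ; relaxed = λ j j<m _ → inj₂ (complete j j<m)
    ; pending = λ v mv → ⊥-elim (<⇒≢ mv (sym (mark≡0 v))) }
    where open Counted I

  -- Seeding and searching preserve the invariant

  State : (ℕ → List ℕ) → ℕ → ℕ → Memory → Set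
  State lists p i σ = InputOf σ × (∀ w → σ 8 w ≡ degree m w) ×
    Searching lists p i (σ 10) (σ 5) (σ 6) (σ 7 0) (σ 9)

  -- The arbitrary continuation R serves both loops that use `visit`. The equations for cells 12 and
  -- 13 are its frame condition: they hold the loop counter of `seed` and the top vertex of
  -- `search`.
  visit-WP : ∀ {lists p i u} R σ → State lists p i σ → p ≤ n → σ 14 0 ≡ u → u < n →
    (Light u → Coreachable u) →
    (∀ τ → State lists p i τ → (Light u → 0 < τ 5 u) → τ 12 0 ≡ σ 12 0 → τ 13 0 ≡ σ 13 0 → R τ) →
    WP W visit R σ
  visit-WP {i = i} R σ (inp , counts , I) p≤n refl u<n reach k = new , old
    where
    open Searching I
    u = σ 14 0

    light : σ 8 u ∸ 1 ≡ 0 → Light u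
    light eq = ≤-trans (≤-reflexive (sym (counts u))) (m∸n≡0⇒m≤n eq)

    new : 0 < 1 ∸ (σ 5 u + (σ 8 u ∸ 1)) → _
    new 0<cond = 1<W , <-trans u<n n<W , ≤-<-trans height<n n<W ,
      k _ (inp , counts , I′) (λ _ → subst (0 <_) (sym (if-≡ {i = u} refl)) (s≤s z≤n)) refl refl
      where
      blocked≡0 : σ 5 u + (σ 8 u ∸ 1) ≡ 0
      blocked≡0 = n<1⇒n≡0 (m∸n≢0⇒n<m (>⇒≢ 0<cond))

      I′ : Searching _ _ i (σ 10) (upd (σ 5) u 1) (upd (σ 6) (σ 7 0) u) (suc (σ 7 0)) (σ 9)
      I′ = push I u<n (m+n≡0⇒m≡0 (σ 5 u) blocked≡0) (reach (light (m+n≡0⇒n≡0 (σ 5 u) blocked≡0)))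

      -- The potential after the push is still p and already includes the new stack entry.
      height<n : σ 7 0 < n
      height<n = ≤-trans (m≤m+n _ _) (≤-trans (≤-reflexive (Searching.potential I′)) p≤n)

    old : 1 ∸ (σ 5 u + (σ 8 u ∸ 1)) ≡ 0 → _
    old cond≡0 = k σ (inp , counts , I) marked refl refl
      where
      marked : Light u → 0 < σ 5 u
      marked light = subst (0 <_)
        (trans (cong (σ 5 u +_) (m≤n⇒m∸n≡0 (≤-trans (≤-reflexive (counts u)) light))) (+-identityʳ (σ 5 u)))
        (m∸n≡0⇒m≤n cond≡0)

  -- The potential remains n throughout, since seeding never pops.
  Seeding : ℕ → Memory → Set
  Seeding k σ = ∃[ lists ] (State lists n (σ 12 0) σ × sumTo n (length ∘ lists) ≡ m × k + σ 12 0 ≡ n)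

  next-seed : ∀ {lists k i τ} → State lists n i τ → sumTo n (length ∘ lists) ≡ m → suc k + i ≡ n →
    i ≡ τ 12 0 → (0 < t i → Light i → 0 < τ 5 i) →
    WP W (12 [ lit 0 ]:= lit 1 ⊕ at! 12) (Seeding k) τ
  next-seed {lists} {k} {i} (inp , counts , I) total k+i≡n refl marked =
    ≤-<-trans (≤-trans (s≤s (m≤n+m i k)) (≤-reflexive k+i≡n)) n<W ,
    lists , (inp , counts , seed-next I marked) , total , trans (+-suc k i) k+i≡n

  seedVertex-WP : ∀ k σ → Seeding k σ → 0 < σ 0 0 ∸ σ 12 0 →
    ∃[ k′ ] (k ≡ suc k′ × WP W seedVertex (Seeding k′) σ)
  seedVertex-WP zero σ (_ , ((eqn , _) , _) , _ , k+i≡n) 0< =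
    ⊥-elim (<⇒≢ 0< (sym (trans (cong (_∸ σ 12 0) eqn) (remaining k+i≡n))))
  seedVertex-WP (suc k) σ (lists , st@(inp@(_ , _ , _ , _ , _ , eq₄) , counts , I) , total , k+i≡n) 0< =
    k , refl , on-target , λ t≡0 → next-seed {τ = σ} st total k+i≡n refl λ 0<t →
      ⊥-elim (<⇒≢ 0<t (trans (sym t≡0) (eq₄ i)))
    where
    i = σ 12 0
    i<n : i < n
    i<n = subst (i <_) k+i≡n (s≤s (m≤n+m i k))

    on-target : 0 < σ 4 i → WP W (14 [ lit 0 ]:= at! 12 ⨾ visit)
      (WP W (12 [ lit 0 ]:= lit 1 ⊕ at! 12) (Seeding k)) σ
    on-target 0<t = <-trans i<n n<W ,
      visit-WP _ (σ [ 14 ∙ 0 ≔ i ]) st ≤-refl refl i<n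
        (base i<n (subst (0 <_) (eq₄ i) 0<t))
        λ τ st′ marked eq _ → next-seed {τ = τ} st′ total k+i≡n (sym eq) (λ _ → marked)

  -- The variant adds the unread arcs to the potential: a pop lowers the one, reading an arc the
  -- other, each by exactly one.
  Popping : ℕ → Memory → Set
  Popping k σ = ∃[ lists ] ∃[ p ] (State lists p n σ × p ≤ n × p + sumTo n (length ∘ lists) ≡ k)

  next-arc : ∀ {lists p k v j js τ} → State lists p n τ → p ≤ n →
    p + sumTo n (length ∘ lists) ≡ suc k → lists v ≡ j ∷ js → v < n → v ≡ τ 13 0 →
    (Light (tl j) → 0 < τ 5 (tl j)) →
    WP W (9 [ at! 13 ]:= 10 at (9 at at! 13 ⊖ lit 1)) (Popping k) τ
  next-arc {lists} {p} {k} {v} {j} {js} {τ} (inp , counts , I) p≤n measure lists≡ v<n refl marked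
    with first≡ , _ , next≤m , _ ← first-arc I lists≡ =
    subst (λ l → τ 10 (l ∸ 1) < W) (sym first≡) (≤-<-trans next≤m (≤-<-trans (m≤m*n m 2) 2m<W)) ,
    updᴸ lists v js , p , (inp , counts , drop-arc I lists≡ marked) , p≤n ,
    suc-injective (trans (sym (+-suc p _)) (trans (cong (p +_) (sym shorter)) measure))
    where
    shorter : sumTo n (length ∘ lists) ≡ suc (sumTo n (length ∘ updᴸ lists v js))
    shorter = sumTo-suc n v<n
      (trans (cong length lists≡) (cong (suc ∘ length) (sym (if-≡ {i = v} refl))))
      (λ w w≢v → cong length (sym (if-≢ (w≢v ∘ sym))))

  searchStep-WP : ∀ k σ → Popping k σ → 0 < σ 7 0 →
    ∃[ k′ ] (k ≡ suc k′ × WP W searchStep (Popping k′) σ)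
  searchStep-WP zero σ (lists , p , (_ , _ , I) , _ , measure) 0<h =
    ⊥-elim (n≮0 (<-≤-trans 0<h (≤-trans (m≤m+n _ _)
      (≤-reflexive (trans (Searching.potential I) (m+n≡0⇒m≡0 p measure))))))
  searchStep-WP (suc k) σ (lists , p , st@(inp@(_ , _ , eq₁ , _) , counts , I) , p≤n , measure) 0<h =
    k , refl , <-trans v<n n<W , drop , shrink
    where
    v = σ 6 (σ 7 0 ∸ 1)
    v<n = proj₁ (top I 0<h)

    shrink : σ 9 v ≡ 0 → WP W (7 [ lit 0 ]:= at! 7 ⊖ lit 1) (Popping k) (σ [ 13 ∙ 0 ≔ v ])
    shrink first≡0 with p′ , refl , I′ ← pop I 0<h first≡0 =
      ≤-<-trans (≤-trans (m≤m+n _ _) (≤-reflexive (Searching.potential I′))) (<-trans p≤n n<W) ,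
      lists , p′ , (inp , counts , I′) , <⇒≤ p≤n , suc-injective measure

    drop : 0 < σ 9 v → WP W
      (14 [ lit 0 ]:= 1 at (9 at at! 13 ⊖ lit 1) ⨾ visit ⨾ 9 [ at! 13 ]:= 10 at (9 at at! 13 ⊖ lit 1))
      (Popping k) (σ [ 13 ∙ 0 ≔ v ])
    drop 0<first with j , js , lists≡ ← nonempty I v 0<first
      with first≡ , _ , _ , j<m , hd≡v ← first-arc I lists≡ =
      subst (_< W) (sym tail≡) (<-trans (tl<n j<m) n<W) ,
      visit-WP _ ((σ [ 13 ∙ 0 ≔ v ]) [ 14 ∙ 0 ≔ σ 1 (σ 9 v ∸ 1) ]) st p≤n tail≡ (tl<n j<m)
        (λ light → step j<m light (subst Coreachable (sym hd≡v) (proj₂ (top I 0<h))))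
        λ τ st′ marked _ eq → next-arc {τ = τ} st′ p≤n measure lists≡ v<n (sym eq) marked
      where
      tail≡ : σ 1 (σ 9 v ∸ 1) ≡ tl j
      tail≡ = trans (eq₁ _) (cong (λ l → tl (l ∸ 1)) first≡)

  -- Final sums and the answer

  Checking : (ℕ → ℕ) → ℕ → Memory → Set
  Checking mark k σ = InputOf σ × σ 5 ≗ mark × k + σ 15 0 ≡ n ×
    σ 16 0 ≡ sumTo (σ 15 0) s × σ 17 0 ≡ sumTo (σ 15 0) t ×
    σ 18 0 ≡ sumTo (σ 15 0) (λ v → s v ∸ mark v)

  checkVertex-WP : ∀ {mark} k σ → Checking mark k σ → 0 < σ 0 0 ∸ σ 15 0 →
    ∃[ k′ ] (k ≡ suc k′ × WP W checkVertex (Checking mark k′) σ)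
  checkVertex-WP zero σ ((eqn , _) , _ , k+i≡n , _) 0< =
    ⊥-elim (<⇒≢ 0< (sym (trans (cong (_∸ σ 15 0) eqn) (remaining k+i≡n))))
  checkVertex-WP {mark} (suc k) σ (inp@(_ , _ , _ , _ , eq₃ , eq₄) , mark≡ , k+i≡n , S≡ , T≡ , B≡) 0< =
    k , refl , bound s≤1 S′ , bound t≤1 T′ , bound (λ v → ≤-trans (m∸n≤m (s v) (mark v)) (s≤1 v)) B′ ,
    ≤-<-trans i<n n<W , inp , mark≡ , trans (+-suc k i) k+i≡n , S′ , T′ , B′
    where
    i = σ 15 0
    i<n : i < n
    i<n = subst (i <_) k+i≡n (s≤s (m≤n+m i k))

    bound : ∀ {f x} → (∀ v → f v ≤ 1) → x ≡ sumTo (suc i) f → x < W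
    bound f≤1 refl = ≤-<-trans (sumTo-≤ (suc i) 1 λ v _ → f≤1 v)
      (≤-<-trans (≤-trans (≤-reflexive (*-identityʳ (suc i))) i<n) n<W)

    S′ : σ 16 0 + σ 3 i ≡ sumTo (suc i) s
    S′ = cong₂ _+_ S≡ (eq₃ i)
    T′ : σ 17 0 + σ 4 i ≡ sumTo (suc i) t
    T′ = cong₂ _+_ T≡ (eq₄ i)
    B′ : σ 18 0 + (σ 3 i ∸ σ 5 i) ≡ sumTo (suc i) (λ v → s v ∸ mark v)
    B′ = cong₂ _+_ B≡ (cong₂ _∸_ (eq₃ i) (mark≡ i))

  Solvable : Set
  Solvable = sumTo n s ≡ sumTo n t × (∀ v → v < n → 0 < s v → Coreachable v)

  Initial : Memory → Set
  Initial σ = InputOf σ × (∀ v → σ 5 v ≡ 0) × (∀ v → σ 8 v ≡ 0) × (∀ v → σ 9 v ≡ 0) × σ 11 0 ≡ 0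

  Marked : Memory → Set
  Marked σ = InputOf σ × (∀ v → 0 < σ 5 v → Coreachable v) × (∀ v → Coreachable v → 0 < σ 5 v)

  Summed : Memory → Set
  Summed σ = σ 16 0 ≡ sumTo n s × σ 17 0 ≡ sumTo n t ×
    Σ (ℕ → ℕ) λ mark → σ 18 0 ≡ sumTo n (λ v → s v ∸ mark v) ×
      (∀ v → 0 < mark v → Coreachable v) × (∀ v → Coreachable v → 0 < mark v)

  Answered : Memory → Set
  Answered σ = (0 < σ 0 0 → Solvable) × (Solvable → 0 < σ 0 0)

  all-positive : ∀ (mark : ℕ → ℕ) → sumTo n (λ v → s v ∸ mark v) ≡ 0 → ∀ v → v < n → 0 < s v → 0 < mark v
  all-positive mark sum≡0 v v<n 0<sv = ≤-trans 0<sv (m∸n≡0⇒m≤n (sumTo-≡0 n {λ v → s v ∸ mark v} sum≡0 v v<n))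

  summed⇒answered : ∀ {σ} → Summed σ →
    (0 < 1 ∸ (σ 18 0 + (σ 16 0 ∸ σ 17 0) + (σ 17 0 ∸ σ 16 0)) → Solvable) ×
    (Solvable → 0 < 1 ∸ (σ 18 0 + (σ 16 0 ∸ σ 17 0) + (σ 17 0 ∸ σ 16 0)))
  summed⇒answered {σ} (S≡ , T≡ , mark , B≡ , sound , complete) = yes⇒ , ⇒yes
    where
    B = σ 18 0
    S = σ 16 0
    U = σ 17 0
    yes⇒ : 0 < 1 ∸ (B + (S ∸ U) + (U ∸ S)) → Solvable
    yes⇒ 0<ans = trans (sym S≡) (trans S≡U T≡) ,
      λ v v<n 0<sv → sound v (all-positive mark
        (trans (sym B≡) (m+n≡0⇒m≡0 B (m+n≡0⇒m≡0 (B + (S ∸ U)) bad≡0))) v v<n 0<sv)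
      where
      bad≡0 : B + (S ∸ U) + (U ∸ S) ≡ 0
      bad≡0 = n<1⇒n≡0 (m∸n≢0⇒n<m (>⇒≢ 0<ans))
      S≡U : S ≡ U
      S≡U = ≤-antisym (m∸n≡0⇒m≤n (m+n≡0⇒n≡0 B (m+n≡0⇒m≡0 (B + (S ∸ U)) bad≡0)))
                      (m∸n≡0⇒m≤n (m+n≡0⇒n≡0 (B + (S ∸ U)) bad≡0))

    ⇒yes : Solvable → 0 < 1 ∸ (B + (S ∸ U) + (U ∸ S))
    ⇒yes (eq , reach) = subst (λ b → 0 < 1 ∸ b) (sym bad≡0) z<s
      where
      S≡U : S ≡ U
      S≡U = trans S≡ (trans eq (sym T≡))
      -- A positive mark cancels s v entirely because s v is at most 1.
      no-gap : ∀ v → v < n → s v ∸ mark v ≡ 0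
      no-gap v v<n with s v in sv≡
      ... | zero  = 0∸n≡0 (mark v)
      ... | suc k = m≤n⇒m∸n≡0 (≤-trans (subst (_≤ 1) sv≡ (s≤1 v))
                      (complete v (reach v v<n (subst (0 <_) (sym sv≡) z<s))))
      bad≡0 : B + (S ∸ U) + (U ∸ S) ≡ 0
      bad≡0 = cong₂ _+_ (cong₂ _+_
        (trans B≡ (trans (sumTo-cong n {λ v → s v ∸ mark v} no-gap) (trans (sumTo-const n 0) (*-zeroʳ n))))
        (m≤n⇒m∸n≡0 (≤-reflexive S≡U))) (m≤n⇒m∸n≡0 (≤-reflexive (sym S≡U)))

  module _ {z : ℕ} (n+m<z : n + m < z) where

    private
      0<z : 0 < z
      0<z = m<n⇒0<n n+m<z
      n<z : n < z
      n<z = ≤-<-trans (m≤m+n n m) n+m<z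
      0<W : 0 < W
      0<W = <-trans z<s 1<W

    countArcs-runs : ∀ σ → Initial σ →
      Runs W z countArcs σ (λ τ → InputOf τ × (∀ v → τ 5 v ≡ 0) × Counted m (τ 8) (τ 9) (τ 10))
    countArcs-runs σ (inp , mark≡0 , count≡0 , first≡0 , j≡0) = runs-map
      (λ τ ((k , inp@(_ , eqm , _) , mark≡0 , k+j≡m , I) , guard≡0) →
        inp , mark≡0 , subst (λ j → Counted j (τ 8) (τ 9) (τ 10)) (finished {i = τ 11 0} eqm k+j≡m guard≡0) I)
      (runs-while _ countArc Counting countArc-WP σ (≤-<-trans (m≤n+m m n) n+m<z)
        (inp , mark≡0 , trans (cong (m +_) j≡0) (+-identityʳ m) ,
         subst (λ j → Counted j (σ 8) (σ 9) (σ 10)) (sym j≡0) (counted-zero count≡0 first≡0)))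

    seed-runs : ∀ σ → InputOf σ × (∀ v → σ 5 v ≡ 0) × Counted m (σ 8) (σ 9) (σ 10) →
      Runs W z seed σ (Popping (n + m))
    seed-runs σ (inp , mark≡0 , I) =
      runs-seq (runs-assign {Q = _≡ σ₁} 0<z 0<W refl) λ { _ refl →
      runs-seq (runs-assign {Q = _≡ σ₂} 0<z 0<W refl) λ { _ refl →
      runs-map
        (λ τ ((k , lists , (inp@(eqn , _) , counts , I) , total , k+i≡n) , guard≡0) →
          lists , n ,
          (inp , counts , subst (λ i → Searching lists n i (τ 10) (τ 5) (τ 6) (τ 7 0) (τ 9))
                            (finished {i = τ 12 0} eqn k+i≡n guard≡0) I) ,
          ≤-refl , cong (n +_) total)
        (runs-while _ seedVertex Seeding seedVertex-WP σ₂ n<z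
          (Counted.lists I , (inp , Counted.counts I , counted⇒searching mark≡0 I) ,
           Counted.total I , +-identityʳ n)) } }
      where
      σ₁ σ₂ : Memory
      σ₁ = σ [ 12 ∙ 0 ≔ 0 ]
      σ₂ = σ₁ [ 7 ∙ 0 ≔ 0 ]

    search-runs : ∀ σ → Popping (n + m) σ → Runs W z search σ Marked
    search-runs σ inv = runs-map
      (λ τ ((k , lists , p , (inp , _ , I) , _) , height≡0) →
        inp , Searching.sound I , λ v r → all-visited I height≡0 r refl)
      (runs-while _ searchStep Popping searchStep-WP σ n+m<z inv)

    check-runs : ∀ σ → Marked σ → Runs W z check σ Summed
    check-runs σ (inp , sound , complete) =
      runs-seq (runs-assign {Q = _≡ σ₁} 0<z 0<W refl) λ { _ refl →
      runs-seq (runs-assign {Q = _≡ σ₂} 0<z 0<W refl) λ { _ refl →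
      runs-seq (runs-assign {Q = _≡ σ₃} 0<z 0<W refl) λ { _ refl →
      runs-seq (runs-assign {Q = _≡ σ₄} 0<z 0<W refl) λ { _ refl →
      runs-map
        (λ τ ((k , (eqn , _) , _ , k+i≡n , S≡ , T≡ , B≡) , guard≡0) →
          let i≡n = finished {i = τ 15 0} eqn k+i≡n guard≡0 in
          trans S≡ (cong (λ i → sumTo i s) i≡n) , trans T≡ (cong (λ i → sumTo i t) i≡n) ,
          σ 5 , trans B≡ (cong (λ i → sumTo i (λ v → s v ∸ σ 5 v)) i≡n) , sound , complete)
        (runs-while _ checkVertex (Checking (σ 5)) checkVertex-WP σ₄ n<z
          (inp , (λ _ → refl) , +-identityʳ n , refl , refl , refl)) } } } }
      where
      σ₁ σ₂ σ₃ σ₄ : Memory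
      σ₁ = σ [ 15 ∙ 0 ≔ 0 ]
      σ₂ = σ₁ [ 16 ∙ 0 ≔ 0 ]
      σ₃ = σ₂ [ 17 ∙ 0 ≔ 0 ]
      σ₄ = σ₃ [ 18 ∙ 0 ≔ 0 ]

    solver-runs : ∀ σ → Initial σ → Runs W z solver σ Answered
    solver-runs σ init =
      runs-seq (countArcs-runs σ init) λ τ counted →
      runs-seq (seed-runs τ counted) λ τ seeded →
      runs-seq (search-runs τ seeded) λ τ marked →
      runs-seq (check-runs τ marked) λ τ summed →
      runs-assign 0<z (≤-<-trans (m∸n≤m 1 (τ 18 0 + (τ 16 0 ∸ τ 17 0) + (τ 17 0 ∸ τ 16 0))) 1<W)
        (summed⇒answered {τ} summed)

-- From instances to arrays

sumTo-front : ∀ k f → sumTo (suc k) f ≡ f 0 + sumTo k (f ∘ suc)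
sumTo-front zero    f = sym (+-identityʳ (f 0))
sumTo-front (suc k) f = trans (cong (_+ f (suc k)) (sumTo-front k f)) (+-assoc (f 0) _ _)

sumTo-nth : ∀ {A : Set} (F : ℕ → ℕ → ℕ) (f g : A → ℕ) as →
  sumTo (length as) (λ j → F (nth 0 (map f as) j) (nth 0 (map g as) j)) ≡ sum (map (λ a → F (f a) (g a)) as)
sumTo-nth F f g []       = refl
sumTo-nth F f g (a ∷ as) = trans (sumTo-front (length as) _) (cong (F (f a) (g a) +_) (sumTo-nth F f g as))

nth-∈ : ∀ {A : Set} (as : List A) {j} → j < length as →
  ∃[ a ] (a ∈ as × ∀ f → nth 0 (map f as) j ≡ f a)
nth-∈ (a ∷ as) {zero}  _   = a , here refl , λ _ → refl
nth-∈ (a ∷ as) {suc j} j< with b , b∈ , eq ← nth-∈ as (s≤s⁻¹ j<) = b , there b∈ , eq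

∈-nth : ∀ {A : Set} {as : List A} {a} → a ∈ as →
  ∃[ j ] (j < length as × ∀ f → nth 0 (map f as) j ≡ f a)
∈-nth (here refl) = 0 , z<s , λ _ → refl
∈-nth (there a∈) with j , j< , eq ← ∈-nth a∈ = suc j , s<s j< , eq

bits : ∀ {n} → Subset n → ℕ → ℕ
bits p = nth 0 (map bit (toList p))

bits≤1 : ∀ {n} (p : Subset n) i → bits p i ≤ 1
bits≤1 []          _       = z≤n
bits≤1 (true  ∷ p) zero    = ≤-refl
bits≤1 (false ∷ p) zero    = z≤n
bits≤1 (_     ∷ p) (suc i) = bits≤1 p i

bits-∈ : ∀ {n} {p : Subset n} {v} → v ∈ₛ p → 0 < bits p (toℕ v)
bits-∈ here       = z<s
bits-∈ (there v∈) = bits-∈ v∈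

∈-bits : ∀ {n} (p : Subset n) v → 0 < bits p (toℕ v) → v ∈ₛ p
∈-bits (true ∷ p) fzero    _  = here
∈-bits (_    ∷ p) (fsuc v) 0< = there (∈-bits p v 0<)

sumTo-bits : ∀ {n} (p : Subset n) → sumTo n (bits p) ≡ ∣ p ∣
sumTo-bits []              = refl
sumTo-bits {suc n} (x ∷ p) = trans (sumTo-front n (bits (x ∷ p))) (tail-sum x (sumTo-bits p))
  where
  tail-sum : ∀ x {k} → k ≡ ∣ p ∣ → bit x + k ≡ ∣ x ∷ p ∣
  tail-sum true  refl = refl
  tail-sum false refl = refl

-- Counter values versus numbers of neighbours

module _ {n : ℕ} (I : Subset n) (w : Fin n) where

  -- Has the shape of `incidence`, so that `sumTo-nth` alone turns a degree into a sum over the list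
  -- of arcs.
  share : ℕ → ℕ → ℕ
  share a b = (if a ≡ᵇ toℕ w then bits I b else 0) + (if b ≡ᵇ toℕ w then bits I a else 0)

  arcShare : Fin n × Fin n → ℕ
  arcShare (a , b) = share (toℕ a) (toℕ b)

  Neighbour : List (Fin n × Fin n) → Fin n → Set
  Neighbour as x = x ∈ₛ I × ((w , x) ∈ as ⊎ (x , w) ∈ as)

  if-positive : ∀ (a x : Fin n) → 0 < (if toℕ a ≡ᵇ toℕ w then bits I (toℕ x) else 0) → a ≡ w × x ∈ₛ I
  if-positive a x 0< with toℕ a ≟ toℕ w
  ... | yes eq = toℕ-injective eq , ∈-bits I x (subst (0 <_) (if-≡ eq) 0<)
  ... | no  ≢  = ⊥-elim (n≮0 (subst (0 <_) (if-≢ ≢) 0<))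

  if-≤1 : ∀ (a x : Fin n) → (if toℕ a ≡ᵇ toℕ w then bits I (toℕ x) else 0) ≤ 1
  if-≤1 a x with toℕ a ≟ toℕ w
  ... | yes eq = subst (_≤ 1) (sym (if-≡ eq)) (bits≤1 I (toℕ x))
  ... | no  ≢  = subst (_≤ 1) (sym (if-≢ ≢)) z≤n

  arcShare-positive : ∀ a {as} → 0 < arcShare a → ∃ (Neighbour (a ∷ as))
  arcShare-positive (a , b) 0< with if toℕ a ≡ᵇ toℕ w then bits I (toℕ b) else 0 in eq
  ... | suc _ with refl , b∈I ← if-positive a b (subst (0 <_) (sym eq) z<s) = b , b∈I , inj₁ (here refl)
  ... | zero  with refl , a∈I ← if-positive b a 0< = a , a∈I , inj₂ (here refl)

  weaken : ∀ {a as} → ∀ {x} → Neighbour as x → Neighbour (a ∷ as) x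
  weaken (x∈I , inj₁ wx) = x∈I , inj₁ (there wx)
  weaken (x∈I , inj₂ xw) = x∈I , inj₂ (there xw)

  shares : List (Fin n × Fin n) → ℕ
  shares as = sum (map arcShare as)

  shares-positive : ∀ as → 0 < shares as → ∃ (Neighbour as)
  shares-positive (a ∷ as) 0< with arcShare a in eq
  ... | suc _ = arcShare-positive a (subst (0 <_) (sym eq) z<s)
  ... | zero  with x , nb ← shares-positive as 0< = x , weaken nb

  neighbour-positive : ∀ {as x} → Neighbour as x → 0 < shares as
  neighbour-positive {x = x} (x∈I , inj₁ (here refl)) =
    ≤-trans (subst (0 <_) (sym (if-≡ {i = toℕ w} refl)) (bits-∈ x∈I)) (≤-trans (m≤m+n _ _) (m≤m+n _ _))
  neighbour-positive {x = x} (x∈I , inj₂ (here refl)) =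
    ≤-trans (subst (0 <_) (sym (if-≡ {i = toℕ w} refl)) (bits-∈ x∈I))
      (≤-trans (m≤n+m _ (if toℕ x ≡ᵇ toℕ w then bits I (toℕ w) else 0)) (m≤m+n _ _))
  neighbour-positive {a ∷ as} (x∈I , inj₁ (there wx)) =
    ≤-trans (neighbour-positive (x∈I , inj₁ wx)) (m≤n+m _ (arcShare a))
  neighbour-positive {a ∷ as} (x∈I , inj₂ (there xw)) =
    ≤-trans (neighbour-positive (x∈I , inj₂ xw)) (m≤n+m _ (arcShare a))

  -- `first` keeps the neighbour for every tail bs. With the empty tail, `neighbour-positive` then
  -- bounds the contribution of the arc a by itself.
  data Split (a : Fin n × Fin n) (as : List (Fin n × Fin n)) (x : Fin n) : Set where
    first : (∀ {bs} → Neighbour (a ∷ bs) x) → a ≡ (w , x) ⊎ a ≡ (x , w) → Split a as x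
    later : Neighbour as x → Split a as x

  split : ∀ {a as x} → Neighbour (a ∷ as) x → Split a as x
  split (x∈I , inj₁ (here refl)) = first (x∈I , inj₁ (here refl)) (inj₁ refl)
  split (x∈I , inj₂ (here refl)) = first (x∈I , inj₂ (here refl)) (inj₂ refl)
  split (x∈I , inj₁ (there wx))  = later (x∈I , inj₁ wx)
  split (x∈I , inj₂ (there xw))  = later (x∈I , inj₂ xw)

  -- Distinct neighbours are joined to w by distinct arcs, and each of these contributes at least
  -- one.
  two-neighbours : ∀ {as x y} → Neighbour as x → Neighbour as y → x ≢ y → 1 < shares as
  two-neighbours {[]}     (_ , inj₁ ()) _ _
  two-neighbours {[]}     (_ , inj₂ ()) _ _
  two-neighbours {a ∷ as} nx ny x≢y with split nx | split ny
  ... | later nx′  | later ny′  = ≤-trans (two-neighbours nx′ ny′ x≢y) (m≤n+m _ (arcShare a))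
  ... | first px _ | later ny′  =
    +-mono-≤ (subst (0 <_) (+-identityʳ _) (neighbour-positive {a ∷ []} px)) (neighbour-positive ny′)
  ... | later nx′  | first py _ =
    +-mono-≤ (subst (0 <_) (+-identityʳ _) (neighbour-positive {a ∷ []} py)) (neighbour-positive nx′)
  ... | first _ (inj₁ refl) | first _ (inj₁ refl) = ⊥-elim (x≢y refl)
  ... | first _ (inj₁ refl) | first _ (inj₂ refl) = ⊥-elim (x≢y refl)
  ... | first _ (inj₂ refl) | first _ (inj₁ refl) = ⊥-elim (x≢y refl)
  ... | first _ (inj₂ refl) | first _ (inj₂ refl) = ⊥-elim (x≢y refl)

  -- Here simplicity of the graph enters. Neighbours found in the first arc and in the rest coincide
  -- only if an arc is repeated or reversed, and a single arc contributes twice only if it is a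
  -- loop.
  many-shares : ∀ {as} → Unique as → (∀ {v} → (v , v) ∉ as) → (∀ {u v} → (u , v) ∈ as → (v , u) ∉ as) →
    1 < shares as → ∃[ x ] ∃[ y ] (Neighbour as x × Neighbour as y × x ≢ y)
  many-shares {a@(u , v) ∷ as} (a∉as ∷ unique) loopless oriented 1<
    with arcShare a in eqₐ | shares as in eqₛ
  ... | zero  | _ with x , y , nx , ny , x≢y ←
          many-shares unique (loopless ∘ there) (λ p q → oriented (there p) (there q))
            (subst (1 <_) (sym eqₛ) 1<) =
        x , y , weaken nx , weaken ny , x≢y
  -- The empty tail forces the neighbour x to come from the first arc.
  ... | suc _ | suc _ with x , nx ← arcShare-positive a {[]} (subst (0 <_) (sym eqₐ) z<s)
                         | y , ny ← shares-positive as (subst (0 <_) (sym eqₛ) z<s)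
      with split nx
  ...   | later (_ , inj₁ ())
  ...   | later (_ , inj₂ ())
  ...   | first px a≡ = x , y , px , weaken ny , λ { refl → distinct a≡ (proj₂ ny) }
    where
    distinct : ∀ {x} → a ≡ (w , x) ⊎ a ≡ (x , w) → (w , x) ∈ as ⊎ (x , w) ∈ as → ⊥
    distinct (inj₁ refl) (inj₁ wx) = All.lookup a∉as wx refl
    distinct (inj₁ refl) (inj₂ xw) = oriented (here refl) (there xw)
    distinct (inj₂ refl) (inj₁ wx) = oriented (here refl) (there wx)
    distinct (inj₂ refl) (inj₂ xw) = All.lookup a∉as xw refl
  many-shares {a@(u , v) ∷ as} (a∉as ∷ unique) loopless oriented 1< | suc k | zero =
    ⊥-elim (loopless (here (sym loop)))
    where
    left right : ℕ
    left  = if toℕ u ≡ᵇ toℕ w then bits I (toℕ v) else 0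
    right = if toℕ v ≡ᵇ toℕ w then bits I (toℕ u) else 0
    1<both : 1 < left + right
    1<both = subst (1 <_) (trans (+-identityʳ _) (sym eqₐ)) 1<
    -- Both halves are at most 1, so a sum above 1 makes both positive and both ends of the arc
    -- equal to w.
    0<left : 0 < left
    0<left = +-cancelʳ-< 1 0 left (<-≤-trans 1<both (+-monoʳ-≤ left (if-≤1 v u)))
    0<right : 0 < right
    0<right = +-cancelˡ-< 1 0 right (<-≤-trans 1<both (+-monoˡ-≤ right (if-≤1 u v)))
    loop : (u , v) ≡ (w , w)
    loop = cong₂ _,_ (proj₁ (if-positive u v 0<left)) (proj₁ (if-positive v u 0<right))

-- Encoded instances and the decision

module _ (x : Instance) (cograph : IsOrientedCograph (graph x)) where

  private
    G = graph x
    S = source x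
    T = target x
    n = order G
    m = length (arcs G)

    tails heads : ℕ → ℕ
    tails = nth 0 (map (toℕ ∘ proj₁) (arcs G))
    heads = nth 0 (map (toℕ ∘ proj₂) (arcs G))

    -- The exponent is 2 because the counters are bounded through m * 2, two units per arc, which
    -- can exceed 2 + `graphSize G`.
    W : ℕ
    W = (2 + graphSize G) ^ 2

    tails<n : ∀ {j} → j < m → tails j < n
    tails<n j<m with (u , v) , _ , eq ← nth-∈ (arcs G) j<m =
      subst (_< n) (sym (eq (toℕ ∘ proj₁))) (toℕ<n u)

    heads<n : ∀ {j} → j < m → heads j < n
    heads<n j<m with (u , v) , _ , eq ← nth-∈ (arcs G) j<m =
      subst (_< n) (sym (eq (toℕ ∘ proj₂))) (toℕ<n v)

    2[2+size]≤W : (2 + graphSize G) * 2 ≤ W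
    2[2+size]≤W = *-monoʳ-≤ (2 + graphSize G)
      (≤-trans (m≤m+n 2 (graphSize G)) (≤-reflexive (sym (*-identityʳ _))))

    size<W : 1 + graphSize G < W
    size<W = ≤-trans (m≤m*n (2 + graphSize G) 2) 2[2+size]≤W

    m*2<W : m * 2 < W
    m*2<W = <-≤-trans (*-monoˡ-< 2 (s≤s (≤-trans (m≤n+m m n) (n≤1+n _)))) 2[2+size]≤W

  open Verification n m tails heads (bits S) (bits T) tails<n heads<n (bits≤1 S) (bits≤1 T)
    W (≤-trans (s≤s (s≤s z≤n)) size<W) (≤-trans (s≤s (≤-trans (m≤m+n n m) (n≤1+n _))) size<W) m*2<W

  degree-shares : ∀ w → degree m (toℕ w) ≡ shares S w (arcs G)
  degree-shares w = sumTo-nth (share S w) (toℕ ∘ proj₁) (toℕ ∘ proj₂) (arcs G)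

  light⇒one : ∀ {w} → Light (toℕ w) → AtMostOneNeighbour (underlying G) S w
  light⇒one {w} light a b a∈S b∈S wa wb with a ≟ᶠ b
  ... | yes a≡b = a≡b
  ... | no  a≢b = ⊥-elim (<⇒≱ (two-neighbours S w (a∈S , wa) (b∈S , wb) a≢b)
                    (≤-trans (≤-reflexive (sym (degree-shares w))) light))

  one⇒light : ∀ {w} → AtMostOneNeighbour (underlying G) S w → Light (toℕ w)
  one⇒light {w} one = ≮⇒≥ λ 1<degree →
    case many-shares S w (unique G) (loopless G) (oriented G)
           (subst (1 <_) (degree-shares w) 1<degree) of λ where
      (a , b , (a∈S , wa) , (b∈S , wb) , a≢b) → a≢b (one a b a∈S b∈S wa wb)

  -- The index of `Coreachable` is an array entry and not syntactically a `toℕ`, so the vertex u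
  -- enters through an equation.
  coreachable⇒reaches : ∀ {v} → Coreachable v → ∀ u → toℕ u ≡ v →
    Reaches G (AtMostOneNeighbour (underlying G) S) T u
  coreachable⇒reaches (base _ 0<t light) u refl = here (∈-bits T u 0<t) (light⇒one light)
  coreachable⇒reaches (step {j} j<m light r) u u≡tail with (p , q) , pq∈ , eq ← nth-∈ (arcs G) j<m
    with refl ← toℕ-injective (trans u≡tail (eq (toℕ ∘ proj₁))) =
    step pq∈ (light⇒one (subst Light (eq (toℕ ∘ proj₁)) light))
      (coreachable⇒reaches r q (sym (eq (toℕ ∘ proj₂))))

  reaches⇒coreachable : ∀ {u} → Reaches G (AtMostOneNeighbour (underlying G) S) T u → Coreachable (toℕ u)
  reaches⇒coreachable {u} (here u∈T one) = base (toℕ<n u) (bits-∈ u∈T) (one⇒light one)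
  reaches⇒coreachable {u} (step uv∈ one r) with j , j<m , eq ← ∈-nth uv∈ =
    subst Coreachable (eq (toℕ ∘ proj₁))
      (step j<m (subst Light (sym (eq (toℕ ∘ proj₁))) (one⇒light one))
        (subst Coreachable (sym (eq (toℕ ∘ proj₂))) (reaches⇒coreachable r)))

  solvable⇒yes : Solvable → YesInstance x
  solvable⇒yes (sums , reach) = feasible⇒sliding G cograph (source-indep x)
    ( trans (sym (sumTo-bits S)) (trans sums (sumTo-bits T))
    , λ {s} s∈S → coreachable⇒reaches (reach (toℕ s) (toℕ<n s) (bits-∈ s∈S)) s refl )

  yes⇒solvable : YesInstance x → Solvable
  yes⇒solvable seq with card , reach ← sliding⇒feasible G cograph seq =
    trans (sumTo-bits S) (trans card (sym (sumTo-bits T))) , λ v v<n 0<sv →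
      let u = fromℕ< v<n
          u≡v = toℕ-fromℕ< v<n
      in subst Coreachable u≡v (reaches⇒coreachable
           (reach (∈-bits S u (subst (λ v → 0 < bits S v) (sym u≡v) 0<sv))))

  answered⇒decided : ∀ {z} → Runs W z solver (load (encodeInstance x)) Answered →
    ∃[ τ ] ∃[ t ] (W ⊢ solver , load (encodeInstance x) ⇓ τ # t
      × t ≤ time solver * z × Reflects (YesInstance x) (accepts τ))
  answered⇒decided (runs {τ} {t} ⇓ t≤ (yes⇒ , ⇒yes)) =
    τ , t , ⇓ , t≤ , fromEquivalence (solvable⇒yes ∘ yes⇒ ∘ <ᵇ⇒< 0 (τ 0 0)) (<⇒<ᵇ ∘ ⇒yes ∘ yes⇒solvable)

  initial : Initial (load (encodeInstance x))
  initial = (refl , refl , (λ _ → refl) , (λ _ → refl) , (λ _ → refl) , λ _ → refl)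
    , (λ _ → refl) , (λ _ → refl) , (λ _ → refl) , refl

  solver-decides : Runs W (suc (graphSize G)) solver (load (encodeInstance x)) Answered
  solver-decides = solver-runs ≤-refl (load (encodeInstance x)) initial

theorem4 : LinearTimeDecidable encodeInstance (graphSize ∘ graph)
    (IsOrientedCograph ∘ graph) YesInstance
-- The loops iterate at most size times, so z = 1 + size gives the running time, and `time solver`
-- is the constant factor.
theorem4 = solver , time solver , 2 , λ x cograph → answered⇒decided x cograph (solver-decides x cograph)
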